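{- For each positive integer $n$, place $n^2$ line-bishops at random on the $3$-dimensional chessboard with side length $n$. Then, as $n\to\infty$, the expected proportion of safe spaces converges to $$\frac{ -1+9e^2-2e^3}{3e^6}.$$
   Context: The $3$-dimensional board of side length $n$ is the set of spaces $\{1,\dots,n\}^3$. "Placing $n^2$ pieces at random" means that the set of occupied spaces (the board configuration) is chosen uniformly among all $\binom{n^3}{n^2}$ subsets of $n^2$ distinct spaces. A line-bishop attacks as a $2$-dimensional bishop inside each axis-parallel $2$-dimensional plane containing it, and attacks no other spaces: a line-bishop at $(a_1,a_2,a_3)$ attacks $(x_1,x_2,x_3)$ if there are two distinct indices $i,j$ with $|x_i-a_i|=|x_j-a_j|$ while the remaining coordinate of the two spaces is equal. A space is safe under a board configuration if it is neither occupied nor attacked by any of the placed pieces. The expected proportion of safe spaces is the expected number of safe spaces divided by $n^3$. -}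

module Defs where

open import Data.Fin using (Fin; toℕ)
import Data.Fin.Properties as Fin
open import Data.Integer using (+_)
import Data.Integer as ℤ
import Data.Integer.Properties as ℤ
open import Data.List using (List; []; _∷_; _++_; map; length; filter; allFin; cartesianProductWith)
open import Data.List.Properties using (length-++; length-map; length-tabulate)
open import Data.List.Membership.Propositional using (_∉_)
import Data.List.Membership.DecPropositional as DecMembership
open import Data.List.Relation.Unary.All using (All; all?)
open import Data.Nat using (ℕ; zero; suc; NonZero; _!)
import Data.Nat as ℕ
open import Data.Nat.ListAction using (sum)
open import Data.Nat.Combinatorics using (_C_; nCk+nC[k+1]≡[n+1]C[k+1])
import Data.Nat.Properties as ℕ
open import Data.Product using (∃-syntax; _×_; _,_; proj₁; proj₂)
open import Data.Rational using (ℚ; 0ℚ; 1ℚ; ½; _/_; 1/_; _+_; _*_; _-_; -_; ∣_∣; _≤_; _<_)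
import Data.Rational as ℚ
import Data.Rational.Properties as ℚ
import Data.Rational.Unnormalised as ℚᵘ
import Data.Rational.Unnormalised.Properties as ℚᵘ
open import Data.Rational.Solver using (module +-*-Solver)
open import Data.Sum using (inj₁; inj₂)
open import Data.Vec using (Vec; []; _∷_; lookup)
open import Data.Vec.Properties using (≡-dec)
open import Relation.Binary.PropositionalEquality using (_≡_; _≢_; refl; sym; trans; cong; cong₂; subst; subst₂)
open import Relation.Nullary using (¬_; Dec; ¬?; _×-dec_; _→-dec_)

------------------------------------------------------------------------
-- Line-bishops

-- The coordinates 1,…,n are numbered 0,…,n-1; only coordinate differences
-- enter the definitions below.
Space : ℕ → Set
Space n = Vec (Fin n) 3

-- The space a itself satisfies this relation too, as it does the defining
-- equations; that is harmless, since an occupied space is never safe.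
_Attacks_ : ∀ {n} → Space n → Space n → Set
a Attacks x =
  ∃[ i ] ∃[ j ] i ≢ j
    × ℕ.∣ toℕ (lookup x i) - toℕ (lookup a i) ∣ ≡ ℕ.∣ toℕ (lookup x j) - toℕ (lookup a j) ∣
    × (∀ k → k ≢ i → k ≢ j → lookup x k ≡ lookup a k)

_attacks?_ : ∀ {n} (a x : Space n) → Dec (a Attacks x)
a attacks? x =
  Fin.any? λ i → Fin.any? λ j → ¬? (i Fin.≟ j)
    ×-dec (_ ℕ.≟ _)
    ×-dec Fin.all? λ k → ¬? (k Fin.≟ i) →-dec (¬? (k Fin.≟ j) →-dec (lookup x k Fin.≟ lookup a k))

-- A board configuration is given by the list of its occupied spaces.
Safe : ∀ {n} → List (Space n) → Space n → Set
Safe B x = x ∉ B × All (λ a → ¬ (a Attacks x)) B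

safe? : ∀ {n} (B : List (Space n)) (x : Space n) → Dec (Safe B x)
safe? B x = (x ∉? B) ×-dec all? (λ a → ¬? (a attacks? x)) B
  where open DecMembership (≡-dec Fin._≟_) using (_∉?_)

------------------------------------------------------------------------
-- Random placement

vecs : ∀ n d → List (Vec (Fin n) d)
vecs n zero    = [] ∷ []
vecs n (suc d) = cartesianProductWith _∷_ (allFin n) (vecs n d)

spaces : ∀ n → List (Space n)
spaces n = vecs n 3

-- All sublists of length k.  For a list without repetitions, such as
-- spaces n, every k-element subset is listed exactly once.
choose : ∀ {A : Set} → ℕ → List A → List (List A)
choose zero    _        = [] ∷ []
choose (suc k) []       = []
choose (suc k) (x ∷ xs) = map (x ∷_) (choose k xs) ++ choose (suc k) xs

configurations : ∀ n → List (List (Space n))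
configurations n = choose (n ℕ.^ 2) (spaces n)

length-vecs : ∀ n d → length (vecs n d) ≡ n ℕ.^ d
length-vecs n zero    = refl
length-vecs n (suc d) =
  trans (length-product (allFin n) (vecs n d))
        (cong₂ ℕ._*_ (length-tabulate {n = n} (λ i → i)) (length-vecs n d))
  where
  length-product : ∀ {m} (xs : List (Fin n)) (ys : List (Vec (Fin n) m)) →
                   length (cartesianProductWith Vec._∷_ xs ys) ≡ length xs ℕ.* length ys
  length-product []       ys = refl
  length-product (x ∷ xs) ys =
    trans (length-++ (map (Vec._∷_ x) ys)) (cong₂ ℕ._+_ (length-map _ ys) (length-product xs ys))

length-choose : ∀ {A : Set} k (xs : List A) → length (choose k xs) ≡ length xs C k
length-choose zero    xs       = refl
length-choose (suc k) []       = refl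
length-choose (suc k) (x ∷ xs) =
  trans (length-++ (map (x ∷_) (choose k xs)))
  (trans (cong₂ ℕ._+_ (trans (length-map _ (choose k xs)) (length-choose k xs))
                      (length-choose (suc k) xs))
         (nCk+nC[k+1]≡[n+1]C[k+1] (length xs) k))

length-configurations : ∀ n → length (configurations n) ≡ (n ℕ.^ 3) C (n ℕ.^ 2)
length-configurations n =
  trans (length-choose (n ℕ.^ 2) (spaces n)) (cong (_C (n ℕ.^ 2)) (length-vecs n 3))

choose-nonZero : ∀ {A : Set} k (xs : List A) → k ℕ.≤ length xs → NonZero (length (choose k xs))
choose-nonZero zero    xs       _         = _
choose-nonZero (suc k) (x ∷ xs) (ℕ.s≤s p) =
  subst NonZero (sym (trans (length-++ (map (x ∷_) (choose k xs)))
                            (cong (ℕ._+ _) (length-map _ (choose k xs)))))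
    (ℕ.>-nonZero (ℕ.<-≤-trans (ℕ.>-nonZero⁻¹ _ ⦃ choose-nonZero k xs p ⦄) (ℕ.m≤m+n _ _)))

configurations-nonZero : ∀ n .⦃ _ : NonZero n ⦄ → NonZero (length (configurations n))
configurations-nonZero n = choose-nonZero (n ℕ.^ 2) (spaces n)
  (subst (n ℕ.^ 2 ℕ.≤_) (sym (length-vecs n 3)) (ℕ.^-monoʳ-≤ n (ℕ.n≤1+n 2)))

-- Expected value of f at a uniformly random entry of the list.
expectation : ∀ {A : Set} (xs : List A) .⦃ _ : NonZero (length xs) ⦄ → (A → ℕ) → ℚ
expectation xs f = + sum (map f xs) / length xs

safeCount : ∀ {n} → List (Space n) → ℕ
safeCount {n} B = length (filter (safe? B) (spaces n))

expectedSafeProportion : ∀ n .⦃ _ : NonZero n ⦄ → ℚ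
expectedSafeProportion n =
  expectation (configurations n) ⦃ configurations-nonZero n ⦄ safeCount
    * (_/_ (+ 1) (n ℕ.^ 3) ⦃ ℕ.m^n≢0 n 3 ⦄)

------------------------------------------------------------------------
-- Real numbers as Cauchy sequences of rationals

Cauchy : (ℕ → ℚ) → Set
Cauchy s = ∀ ε → 0ℚ < ε → ∃[ N ] ∀ m n → N ℕ.≤ m → N ℕ.≤ n → ∣ s m - s n ∣ < ε

-- There is no η-equality, and the operations are defined by copatterns, so
-- that Agda does not unfold real expressions when comparing types; unfolding
-- them would reach the normalisation of fractions in ℚ.
record ℝ : Set where
  no-eta-equality
  field
    seq    : ℕ → ℚ
    cauchy : Cauchy seq

open ℝ public

0<½* : ∀ {ε} → 0ℚ < ε → 0ℚ < ½ * ε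
0<½* {ε} p = subst (_< ½ * ε) (ℚ.*-zeroʳ ½) (ℚ.*-monoʳ-<-pos ½ p)

½+½ : ∀ ε → ½ * ε + ½ * ε ≡ ε
½+½ ε = trans (sym (ℚ.*-distribʳ-+ ε ½ ½)) (ℚ.*-identityˡ ε)

0<* : ∀ {p q} → 0ℚ < p → 0ℚ < q → 0ℚ < p * q
0<* {p} {q} a b = subst (_< p * q) (ℚ.*-zeroʳ p) (ℚ.*-monoʳ-<-pos p ⦃ ℚ.positive a ⦄ b)

0<+ : ∀ {p q} → 0ℚ < p → 0ℚ < q → 0ℚ < p + q
0<+ a b = ℚ.+-mono-< a b

*-mono : ∀ {p q r s} → 0ℚ ≤ r → 0ℚ ≤ q → p ≤ q → r ≤ s → p * r ≤ q * s
*-mono {p} {q} {r} {s} 0≤r 0≤q p≤q r≤s =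
  ℚ.≤-trans (ℚ.*-monoʳ-≤-nonNeg r ⦃ ℚ.nonNegative 0≤r ⦄ p≤q)
            (ℚ.*-monoˡ-≤-nonNeg q ⦃ ℚ.nonNegative 0≤q ⦄ r≤s)

+-difference : ∀ a b c d → (a - b) + (c - d) ≡ (a + c) - (b + d)
+-difference = solve 4 (λ a b c d → (a :- b) :+ (c :- d) := (a :+ c) :- (b :+ d)) refl
  where open +-*-Solver

neg-difference : ∀ a b → b - a ≡ - a - (- b)
neg-difference = solve 2 (λ a b → b :- a := :- a :- (:- b)) refl
  where open +-*-Solver

*-difference : ∀ a b c d → c * (a - b) + b * (c - d) ≡ a * c - b * d
*-difference = solve 4 (λ a b c d → c :* (a :- b) :+ b :* (c :- d) := a :* c :- b :* d) refl
  where open +-*-Solver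

reciprocal-difference : ∀ a b i j → (a - b) * (i * j) ≡ (a * i) * j - (b * j) * i
reciprocal-difference =
  solve 4 (λ a b i j → (a :- b) :* (i :* j) := (a :* i) :* j :- (b :* j) :* i) refl
  where open +-*-Solver

*-regroup : ∀ e d i j → e * ((d * i) * (d * j)) ≡ (e * (d * d)) * (i * j)
*-regroup = solve 4 (λ e d i j → e :* ((d :* i) :* (d :* j)) := (e :* (d :* d)) :* (i :* j)) refl
  where open +-*-Solver

*-factor : ∀ A B i e → B * (i * e) + A * (i * e) ≡ ((A + B) * i) * e
*-factor = solve 4 (λ A B i e → B :* (i :* e) :+ A :* (i :* e) := ((A :+ B) :* i) :* e) refl
  where open +-*-Solver

opposite : ∀ a b → b - a ≡ - (a - b)
opposite = solve 2 (λ a b → b :- a := :- (a :- b)) refl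
  where open +-*-Solver

∣-∣-sym : ∀ p q → ∣ p - q ∣ ≡ ∣ q - p ∣
∣-∣-sym p q = trans (cong ∣_∣ (opposite q p)) (ℚ.∣-p∣≡∣p∣ (q - p))

∣p∣≤∣p-q∣+∣q∣ : ∀ p q → ∣ p ∣ ≤ ∣ p - q ∣ + ∣ q ∣
∣p∣≤∣p-q∣+∣q∣ p q =
  subst (_≤ ∣ p - q ∣ + ∣ q ∣) (cong ∣_∣ (solve 2 (λ p q → (p :- q) :+ q := p) refl p q))
        (ℚ.∣p+q∣≤∣p∣+∣q∣ (p - q) q)
  where open +-*-Solver

p≤q+r⇒p-r≤q : ∀ {p q r} → p ≤ q + r → p - r ≤ q
p≤q+r⇒p-r≤q {p} {q} {r} a =
  subst (p - r ≤_) (solve 2 (λ q r → (q :+ r) :- r := q) refl q r) (ℚ.+-monoˡ-≤ (- r) a)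
  where open +-*-Solver

∣∣p∣-∣q∣∣≤∣p-q∣ : ∀ p q → ∣ ∣ p ∣ - ∣ q ∣ ∣ ≤ ∣ p - q ∣
∣∣p∣-∣q∣∣≤∣p-q∣ p q with ℚ.∣p∣≡p∨∣p∣≡-p (∣ p ∣ - ∣ q ∣)
... | inj₁ e = subst (_≤ ∣ p - q ∣) (sym e) (p≤q+r⇒p-r≤q (∣p∣≤∣p-q∣+∣q∣ p q))
... | inj₂ e = subst₂ _≤_ (trans (opposite ∣ p ∣ ∣ q ∣) (sym e))
                          (∣-∣-sym q p) (p≤q+r⇒p-r≤q (∣p∣≤∣p-q∣+∣q∣ q p))

fromℚ : ℚ → ℝ
fromℚ q .seq    _     = q
fromℚ q .cauchy ε 0<ε = 0 , λ _ _ _ _ → subst (λ z → ∣ z ∣ < ε) (sym (ℚ.+-inverseʳ q)) 0<ε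

fromℕ : ℕ → ℝ
fromℕ n .seq    = seq (fromℚ (+ n / 1))
fromℕ n .cauchy = cauchy (fromℚ (+ n / 1))

infixl 6 _+ᵣ_ _-ᵣ_
infixl 7 _*ᵣ_
infix  8 -ᵣ_
infixr 9 _^ᵣ_
infix  4 _<ᵣ_

_+ᵣ_ : ℝ → ℝ → ℝ
(x +ᵣ y) .seq    k = seq x k + seq y k
(x +ᵣ y) .cauchy   = c
  where
  c : Cauchy (λ k → seq x k + seq y k)
  c ε 0<ε with cauchy x (½ * ε) (0<½* 0<ε) | cauchy y (½ * ε) (0<½* 0<ε)
  ... | M , f | N , g = M ℕ.⊔ N , λ m n p q →
    subst (∣ (seq x m + seq y m) - (seq x n + seq y n) ∣ <_) (½+½ ε)
      (ℚ.≤-<-trans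
        (subst (_≤ ∣ seq x m - seq x n ∣ + ∣ seq y m - seq y n ∣)
          (cong ∣_∣ (+-difference (seq x m) (seq x n) (seq y m) (seq y n)))
          (ℚ.∣p+q∣≤∣p∣+∣q∣ (seq x m - seq x n) (seq y m - seq y n)))
        (ℚ.+-mono-< (f m n (ℕ.m⊔n≤o⇒m≤o M N p) (ℕ.m⊔n≤o⇒m≤o M N q))
                    (g m n (ℕ.m⊔n≤o⇒n≤o M N p) (ℕ.m⊔n≤o⇒n≤o M N q))))

-ᵣ_ : ℝ → ℝ
(-ᵣ x) .seq    k = - seq x k
(-ᵣ x) .cauchy   = c
  where
  c : Cauchy (λ k → - seq x k)
  c ε 0<ε with cauchy x ε 0<ε
  ... | N , f = N , λ m n p q →
    subst (_< ε) (trans (∣-∣-sym (seq x m) (seq x n))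
                        (cong ∣_∣ (neg-difference (seq x m) (seq x n))))
          (f m n p q)

_-ᵣ_ : ℝ → ℝ → ℝ
x -ᵣ y = x +ᵣ (-ᵣ y)

∣_∣ᵣ : ℝ → ℝ
∣ x ∣ᵣ .seq    k = ∣ seq x k ∣
∣ x ∣ᵣ .cauchy   = c
  where
  c : Cauchy (λ k → ∣ seq x k ∣)
  c ε 0<ε with cauchy x ε 0<ε
  ... | N , f = N , λ m n p q → ℚ.≤-<-trans (∣∣p∣-∣q∣∣≤∣p-q∣ (seq x m) (seq x n)) (f m n p q)

eventuallyBounded : ∀ x → ∃[ M ] 0ℚ < M × ∃[ N ] ∀ k → N ℕ.≤ k → ∣ seq x k ∣ < M
eventuallyBounded x with cauchy x 1ℚ (ℚ.positive⁻¹ 1ℚ)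
... | N , f = 1ℚ + ∣ seq x N ∣
            , ℚ.+-mono-<-≤ (ℚ.positive⁻¹ 1ℚ) (ℚ.0≤∣p∣ (seq x N))
            , N
            , λ k p → ℚ.≤-<-trans (∣p∣≤∣p-q∣+∣q∣ (seq x k) (seq x N))
                                  (ℚ.+-monoˡ-< ∣ seq x N ∣ (f k N p ℕ.≤-refl))

splitting : ∀ {A B ε} → 0ℚ < A → 0ℚ < B → 0ℚ < ε → ∃[ δ ] 0ℚ < δ × B * δ + A * δ ≡ ε
splitting {A} {B} {ε} 0<A 0<B 0<ε =
  i * ε
  , 0<* (ℚ.positive⁻¹ i ⦃ ℚ.1/pos⇒pos (A + B) ⦃ ℚ.positive 0<S ⦄ ⦄) 0<ε
  , trans (*-factor A B i ε)
          (trans (cong (_* ε) (ℚ.*-inverseʳ (A + B) ⦃ ℚ.>-nonZero 0<S ⦄)) (ℚ.*-identityˡ ε))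
  where
  0<S : 0ℚ < A + B
  0<S = 0<+ 0<A 0<B
  i : ℚ
  i = (1/ (A + B)) ⦃ ℚ.>-nonZero 0<S ⦄

∣*∣-< : ∀ u v {U δ} → ∣ u ∣ < U → 0ℚ < U → ∣ v ∣ < δ → ∣ u * v ∣ < U * δ
∣*∣-< u v {U} {δ} p 0<U q =
  subst (_< U * δ) (sym (ℚ.∣p*q∣≡∣p∣*∣q∣ u v))
    (ℚ.≤-<-trans (ℚ.*-monoʳ-≤-nonNeg ∣ v ∣ ⦃ ℚ.∣-∣-nonNeg v ⦄ (ℚ.<⇒≤ p))
                 (ℚ.*-monoʳ-<-pos U ⦃ ℚ.positive 0<U ⦄ q))

*-difference-< : ∀ a b c d {A B δ} → 0ℚ < A → 0ℚ < B → ∣ b ∣ < A → ∣ c ∣ < B →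
                 ∣ a - b ∣ < δ → ∣ c - d ∣ < δ → ∣ a * c - b * d ∣ < B * δ + A * δ
*-difference-< a b c d {A} {B} {δ} 0<A 0<B b< c< ab< cd< =
  ℚ.≤-<-trans
    (subst (λ z → ∣ z ∣ ≤ ∣ c * (a - b) ∣ + ∣ b * (c - d) ∣) (*-difference a b c d)
      (ℚ.∣p+q∣≤∣p∣+∣q∣ (c * (a - b)) (b * (c - d))))
    (ℚ.+-mono-< (∣*∣-< c (a - b) c< 0<B ab<) (∣*∣-< b (c - d) b< 0<A cd<))

_*ᵣ_ : ℝ → ℝ → ℝ
(x *ᵣ y) .seq    k = seq x k * seq y k
(x *ᵣ y) .cauchy   = c
  where
  c : Cauchy (λ k → seq x k * seq y k)
  c ε 0<ε =
    let A , 0<A , K , a = eventuallyBounded x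
        B , 0<B , L , b = eventuallyBounded y
        δ , 0<δ , eq    = splitting 0<A 0<B 0<ε
        P , f           = cauchy x δ 0<δ
        Q , g           = cauchy y δ 0<δ
    in (K ℕ.⊔ L) ℕ.⊔ (P ℕ.⊔ Q) , λ m n p q →
    let m≥KL = ℕ.m⊔n≤o⇒m≤o (K ℕ.⊔ L) (P ℕ.⊔ Q) p
        n≥KL = ℕ.m⊔n≤o⇒m≤o (K ℕ.⊔ L) (P ℕ.⊔ Q) q
        m≥PQ = ℕ.m⊔n≤o⇒n≤o (K ℕ.⊔ L) (P ℕ.⊔ Q) p
        n≥PQ = ℕ.m⊔n≤o⇒n≤o (K ℕ.⊔ L) (P ℕ.⊔ Q) q
    in subst (∣ seq x m * seq y m - seq x n * seq y n ∣ <_) eq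
         (*-difference-< (seq x m) (seq x n) (seq y m) (seq y n) 0<A 0<B
           (a n (ℕ.m⊔n≤o⇒m≤o K L n≥KL))
           (b m (ℕ.m⊔n≤o⇒n≤o K L m≥KL))
           (f m n (ℕ.m⊔n≤o⇒m≤o P Q m≥PQ) (ℕ.m⊔n≤o⇒m≤o P Q n≥PQ))
           (g m n (ℕ.m⊔n≤o⇒n≤o P Q m≥PQ) (ℕ.m⊔n≤o⇒n≤o P Q n≥PQ)))

_^ᵣ_ : ℝ → ℕ → ℝ
x ^ᵣ zero  = fromℕ 1
x ^ᵣ suc n = x *ᵣ x ^ᵣ n

-- x > 0: from some index on, the terms are at least a fixed rational δ > 0.
record Positiveᵣ (x : ℝ) : Set where
  constructor mkPositive
  field
    {δ}  : ℚ
    0<δ  : 0ℚ < δ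
    from : ℕ
    δ≤   : ∀ k → from ℕ.≤ k → δ ≤ seq x k

_<ᵣ_ : ℝ → ℝ → Set
x <ᵣ y = Positiveᵣ (y -ᵣ x)

module Reciprocal (x : ℝ) {δ} (0<δ : 0ℚ < δ) (N : ℕ) (δ≤x : ∀ k → N ℕ.≤ k → δ ≤ seq x k) where

  δ≤ : ∀ k → δ ≤ seq x (N ℕ.+ k)
  δ≤ k = δ≤x (N ℕ.+ k) (ℕ.m≤m+n N k)

  0<x : ∀ k → 0ℚ < seq x (N ℕ.+ k)
  0<x k = ℚ.<-≤-trans 0<δ (δ≤ k)

  s : ℕ → ℚ
  s k = (1/ seq x (N ℕ.+ k)) ⦃ ℚ.>-nonZero (0<x k) ⦄

  0<s : ∀ k → 0ℚ < s k
  0<s k = ℚ.positive⁻¹ (s k) ⦃ ℚ.1/pos⇒pos (seq x (N ℕ.+ k)) ⦃ ℚ.positive (0<x k) ⦄ ⦄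

  xs≡1 : ∀ k → seq x (N ℕ.+ k) * s k ≡ 1ℚ
  xs≡1 k = ℚ.*-inverseʳ (seq x (N ℕ.+ k)) ⦃ ℚ.>-nonZero (0<x k) ⦄

  δs≤1 : ∀ k → δ * s k ≤ 1ℚ
  δs≤1 k = subst (δ * s k ≤_) (xs≡1 k)
             (ℚ.*-monoʳ-≤-nonNeg (s k) ⦃ ℚ.nonNegative (ℚ.<⇒≤ (0<s k)) ⦄ (δ≤ k))

  difference : ∀ m n → (seq x (N ℕ.+ m) - seq x (N ℕ.+ n)) * (s m * s n) ≡ s n - s m
  difference m n =
    trans (reciprocal-difference (seq x (N ℕ.+ m)) (seq x (N ℕ.+ n)) (s m) (s n))
          (cong₂ _-_ (trans (cong (_* s n) (xs≡1 m)) (ℚ.*-identityˡ (s n)))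
                     (trans (cong (_* s m) (xs≡1 n)) (ℚ.*-identityˡ (s m))))

  s-cauchy : Cauchy s
  s-cauchy ε 0<ε = let M , f = cauchy x (ε * (δ * δ)) (0<* 0<ε (0<* 0<δ 0<δ)) in
    M , λ m n p q →
    let u    = seq x (N ℕ.+ m) - seq x (N ℕ.+ n)
        0<ss = 0<* (0<s m) (0<s n)
    in subst (_< ε)
         (trans (cong (∣ u ∣ *_) (sym (ℚ.0≤p⇒∣p∣≡p (ℚ.<⇒≤ 0<ss))))
         (trans (sym (ℚ.∣p*q∣≡∣p∣*∣q∣ u (s m * s n)))
         (trans (cong ∣_∣ (difference m n)) (∣-∣-sym (s n) (s m)))))
         (ℚ.<-≤-trans
           (ℚ.*-monoˡ-<-pos (s m * s n) ⦃ ℚ.positive 0<ss ⦄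
             (f (N ℕ.+ m) (N ℕ.+ n) (ℕ.≤-trans p (ℕ.m≤n+m m N)) (ℕ.≤-trans q (ℕ.m≤n+m n N))))
           (subst₂ _≤_
             (*-regroup ε δ (s m) (s n))
             (ℚ.*-identityʳ ε)
             (ℚ.*-monoˡ-≤-nonNeg ε ⦃ ℚ.nonNegative (ℚ.<⇒≤ 0<ε) ⦄
               (*-mono (ℚ.<⇒≤ (0<* 0<δ (0<s n))) (ℚ.nonNegative⁻¹ 1ℚ) (δs≤1 m) (δs≤1 n)))))

-- The terms before position from, some of which may be zero, are dropped.
infix 9 1/ᵣ_
1/ᵣ_ : ∀ x ⦃ _ : Positiveᵣ x ⦄ → ℝ
(1/ᵣ x) ⦃ mkPositive 0<δ from δ≤ ⦄ .seq    = Reciprocal.s x 0<δ from δ≤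
(1/ᵣ x) ⦃ mkPositive 0<δ from δ≤ ⦄ .cauchy = Reciprocal.s-cauchy x 0<δ from δ≤

infixl 7 _/ᵣ_
_/ᵣ_ : ∀ (x y : ℝ) ⦃ _ : Positiveᵣ y ⦄ → ℝ
x /ᵣ y = x *ᵣ 1/ᵣ y

instance
  fromℕ-positive : ∀ {n} → Positiveᵣ (fromℕ (suc n))
  fromℕ-positive {n} =
    mkPositive (ℚ.positive⁻¹ (+ suc n / 1) ⦃ ℚ.normalize-pos (suc n) 1 ⦄) 0 λ _ _ → ℚ.≤-refl

  *ᵣ-positive : ∀ {x y} ⦃ _ : Positiveᵣ x ⦄ ⦃ _ : Positiveᵣ y ⦄ → Positiveᵣ (x *ᵣ y)
  *ᵣ-positive ⦃ mkPositive 0<δ M f ⦄ ⦃ mkPositive 0<η N g ⦄ =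
    mkPositive (0<* 0<δ 0<η) (M ℕ.⊔ N) λ k p →
      let δ≤x = f k (ℕ.m⊔n≤o⇒m≤o M N p)
      in *-mono (ℚ.<⇒≤ 0<η) (ℚ.≤-trans (ℚ.<⇒≤ 0<δ) δ≤x) δ≤x (g k (ℕ.m⊔n≤o⇒n≤o M N p))

Converges : ((n : ℕ) .⦃ _ : NonZero n ⦄ → ℝ) → ℝ → Set
Converges u x =
  ∀ ε → Positiveᵣ ε → ∃[ N ] ∀ n .⦃ _ : NonZero n ⦄ → N ℕ.≤ n → ∣ u n -ᵣ x ∣ᵣ <ᵣ ε

------------------------------------------------------------------------
-- e = 1/0! + 1/1! + 1/2! + …

1/!_ : ℕ → ℚ
1/! n = _/_ (+ 1) (n !) ⦃ n ℕ.!≢0 ⦄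

eSum : ℕ → ℚ
eSum zero    = 1/! 0
eSum (suc n) = eSum n + 1/! suc n

toℚᵘ-1/ : ∀ b → ℚ.toℚᵘ (+ 1 / suc b) ℚᵘ.≃ ℚᵘ.mkℚᵘ (+ 1) b
toℚᵘ-1/ b = ℚ.toℚᵘ-fromℚᵘ (ℚᵘ.mkℚᵘ (+ 1) b)

halving : ∀ a b .⦃ _ : NonZero a ⦄ .⦃ _ : NonZero b ⦄ → a ℕ.+ a ℕ.≤ b → + 1 / b + + 1 / b ≤ + 1 / a
halving (suc a) (suc b) 2a≤b = ℚ.toℚᵘ-cancel-≤ (begin
  ℚ.toℚᵘ (+ 1 / suc b + + 1 / suc b)               ≃⟨ ℚ.toℚᵘ-homo-+ (+ 1 / suc b) (+ 1 / suc b) ⟩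
  ℚ.toℚᵘ (+ 1 / suc b) ℚᵘ.+ ℚ.toℚᵘ (+ 1 / suc b)   ≃⟨ ℚᵘ.+-cong (toℚᵘ-1/ b) (toℚᵘ-1/ b) ⟩
  ℚᵘ.mkℚᵘ (+ 1) b ℚᵘ.+ ℚᵘ.mkℚᵘ (+ 1) b             ≤⟨ ℚᵘ.*≤* (ℤ.+≤+ lemma) ⟩
  ℚᵘ.mkℚᵘ (+ 1) a                                  ≃⟨ ℚᵘ.≃-sym (toℚᵘ-1/ a) ⟩
  ℚ.toℚᵘ (+ 1 / suc a)                             ∎)
  where
  open ℚᵘ.≤-Reasoning
  lemma : (1 ℕ.* suc b ℕ.+ 1 ℕ.* suc b) ℕ.* suc a ℕ.≤ 1 ℕ.* (suc b ℕ.* suc b)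
  lemma = subst₂ ℕ._≤_
    (trans (ℕ.*-distribˡ-+ (suc b) (suc a) (suc a))
      (trans (sym (ℕ.*-distribʳ-+ (suc a) (suc b) (suc b)))
             (cong (λ z → (z ℕ.+ z) ℕ.* suc a) (sym (ℕ.*-identityˡ (suc b))))))
    (sym (ℕ.*-identityˡ (suc b ℕ.* suc b)))
    (ℕ.*-monoʳ-≤ (suc b) 2a≤b)

1/!-halves : ∀ n → 1/! suc (suc n) + 1/! suc (suc n) ≤ 1/! suc n
1/!-halves n =
  halving (suc n !) (suc (suc n) !) ⦃ suc n ℕ.!≢0 ⦄ ⦃ suc (suc n) ℕ.!≢0 ⦄
    (ℕ.+-monoʳ-≤ (suc n !) (ℕ.m≤m+n (suc n !) (n ℕ.* suc n !)))

1/-small : ∀ b .⦃ _ : NonZero b ⦄ ε → 0ℚ < ε → ℚ.↧ₙ ε ℕ.< b → + 1 / b < ε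
1/-small (suc b) (ℚ.mkℚ ℤ.+0 d _) (ℚ.*<* (ℤ.+<+ ())) _
1/-small (suc b) (ℚ.mkℚ ℤ.-[1+ _ ] d _) (ℚ.*<* ()) _
1/-small (suc b) ε@(ℚ.mkℚ ℤ.+[1+ p ] d _) _ d<b = ℚ.toℚᵘ-cancel-<
  (ℚᵘ.<-respˡ-≃ (ℚᵘ.≃-sym (toℚᵘ-1/ b)) (ℚᵘ.*<* (ℤ.+<+ lemma)))
  where
  lemma : 1 ℕ.* suc d ℕ.< suc p ℕ.* suc b
  lemma = ℕ.≤-<-trans (ℕ.≤-reflexive (ℕ.*-identityˡ (suc d)))
            (ℕ.<-≤-trans d<b (ℕ.m≤m+n (suc b) (p ℕ.* suc b)))

1/!-nonNeg : ∀ n → 0ℚ ≤ 1/! n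
1/!-nonNeg n = ℚ.nonNegative⁻¹ (1/! n) ⦃ ℚ.normalize-nonNeg 1 (n !) ⦃ n ℕ.!≢0 ⦄ ⦄

≤-+ʳ : ∀ p {q} → 0ℚ ≤ q → p ≤ p + q
≤-+ʳ p {q} 0≤q = subst (_≤ p + q) (ℚ.+-identityʳ p) (ℚ.+-monoʳ-≤ p 0≤q)

eSum-lower : ∀ N k → eSum N ≤ eSum (k ℕ.+ N)
eSum-lower N zero    = ℚ.≤-refl
eSum-lower N (suc k) =
  ℚ.≤-trans (eSum-lower N k) (≤-+ʳ (eSum (k ℕ.+ N)) (1/!-nonNeg (suc (k ℕ.+ N))))

eSum-upper : ∀ N k → eSum (k ℕ.+ suc N) + 1/! (k ℕ.+ suc N) ≤ eSum (suc N) + 1/! suc N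
eSum-upper N zero    = ℚ.≤-refl
eSum-upper N (suc k) = ℚ.≤-trans step (eSum-upper N k)
  where
  step : eSum (k ℕ.+ suc N) + 1/! suc (k ℕ.+ suc N) + 1/! suc (k ℕ.+ suc N)
           ≤ eSum (k ℕ.+ suc N) + 1/! (k ℕ.+ suc N)
  step = subst (λ j → eSum j + 1/! suc j + 1/! suc j ≤ eSum j + 1/! j) (sym (ℕ.+-suc k N))
    (subst (_≤ eSum (suc (k ℕ.+ N)) + 1/! suc (k ℕ.+ N))
      (sym (ℚ.+-assoc (eSum (suc (k ℕ.+ N))) (1/! suc (suc (k ℕ.+ N))) (1/! suc (suc (k ℕ.+ N)))))
      (ℚ.+-monoʳ-≤ (eSum (suc (k ℕ.+ N))) (1/!-halves (k ℕ.+ N))))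

gap : ∀ l w p q → l ≤ q → p ≤ l + w → p - q ≤ w
gap l w p q l≤q p≤ = p≤q+r⇒p-r≤q
  (ℚ.≤-trans p≤ (subst (_≤ w + q) (ℚ.+-comm w l) (ℚ.+-monoʳ-≤ w l≤q)))

∣-∣-within : ∀ l w a b → l ≤ a → a ≤ l + w → l ≤ b → b ≤ l + w → ∣ a - b ∣ ≤ w
∣-∣-within l w a b l≤a a≤ l≤b b≤ with ℚ.∣p∣≡p∨∣p∣≡-p (a - b)
... | inj₁ eq = subst (_≤ w) (sym eq) (gap l w a b l≤b a≤)
... | inj₂ eq = subst (_≤ w) (trans (opposite a b) (sym eq)) (gap l w b a l≤a b≤)

eSum-cauchy : Cauchy eSum
eSum-cauchy ε 0<ε = N , λ m n p q →
  ℚ.≤-<-trans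
    (∣-∣-within (eSum N) (1/! N) (eSum m) (eSum n) (lower p) (upper p) (lower q) (upper q))
    (1/-small (N !) ⦃ N ℕ.!≢0 ⦄ ε 0<ε (ℕ.m≤m*n N (ℚ.↧ₙ ε !) ⦃ ℚ.↧ₙ ε ℕ.!≢0 ⦄))
  where
  N : ℕ
  N = suc (ℚ.↧ₙ ε)
  lower : ∀ {m} → N ℕ.≤ m → eSum N ≤ eSum m
  lower {m} p = subst (λ j → eSum N ≤ eSum j) (ℕ.m∸n+n≡m p) (eSum-lower N (m ℕ.∸ N))
  upper : ∀ {m} → N ℕ.≤ m → eSum m ≤ eSum N + 1/! N
  upper {m} p = subst (λ j → eSum j ≤ eSum N + 1/! N) (ℕ.m∸n+n≡m p)
    (ℚ.≤-trans (≤-+ʳ (eSum (m ℕ.∸ N ℕ.+ N)) (1/!-nonNeg (m ℕ.∸ N ℕ.+ N)))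
               (eSum-upper (ℚ.↧ₙ ε) (m ℕ.∸ N)))

e : ℝ
e .seq    = eSum
e .cauchy = eSum-cauchy

instance
  e-positive : Positiveᵣ e
  e-positive = mkPositive (ℚ.positive⁻¹ 1ℚ) 0 λ k _ →
    subst (λ j → eSum 0 ≤ eSum j) (ℕ.+-identityʳ k) (eSum-lower 0 k)

{-# OPTIONS --safe #-}

-- A space x stays safe exactly when no piece occupies one of the A(x) spaces
-- that attack x (x itself included), so the expected proportion of safe spaces
-- is the mean over x of C(n³ - A(x), n²) / C(n³, n²).  This ratio is (1 - p)^A(x)
-- up to O(p), where p = 1/n.  A bishop count in the three planes gives
-- A(x) + 2 = 3n + 2 Σ min(mᵢ, mⱼ), where mᵢ is the distance of the i-th
-- coordinate from the boundary.  Peeling off the outer layer of the board gives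
-- a recursion in the side length for the sum of (1 - p)^(2 Σ min(mᵢ, mⱼ)), which
-- is solved up to O(p) by a polynomial in p·n and w = (1 - p)^n, so that the
-- proportion is w³(9w - 2 - w³)/3 + O(p).  Finally w·Σ_{j≤k} 1/j! lies in
-- [1 - p , 1] for all k ≥ n.
module Submission where

open import Defs
open import Data.Fin using (Fin; zero; suc; toℕ; inject₁)
import Data.Fin
import Data.Fin.Properties as Fin
open import Data.List using (List; map; length; filter)
open import Data.Nat using (ℕ; zero; suc; NonZero; _⊓_; _∸_; _!; z≤n; s≤s)
import Data.Nat as ℕ
import Data.Nat.ListAction as ℕ
import Data.Nat.Properties as ℕ
import Data.Nat.Solver as ℕ
open import Data.Nat.Combinatorics using (_C_; nCk+nC[k+1]≡[n+1]C[k+1]; k>n⇒nCk≡0; nC1≡n)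
open import Data.Product using (_×_; _,_; proj₂)
open import Data.Vec using (Vec; []; _∷_; lookup)
open import Function using (_∘_; _⇔_; mk⇔)
open import Level using (0ℓ)
open import Relation.Binary.PropositionalEquality

-- Until the last step everything is an inequality between rationals with explicit constants. The
-- limit is a Cauchy sequence whose k-th term is the given expression at E = `eSum k`, so the goal
-- becomes a bound 562/n on the distance between the proportion and that term, uniformly in k ≥ n ≥
-- 3. No exponential function on the reals is needed: the powers (1 - p)^m stand for its values at
-- -pm. Two recursions are solved approximately, one in the number of avoided spaces and one in the
-- side length. In both, a step multiplies the previous error by a factor of absolute value at most
-- 1 and adds an error of order p². There are O(n) = O(1/p) steps, so the errors add up to O(p). The
-- limit and the cubic sum are multiplied by 3 to keep integer coefficients.

module Counting where

  open import Data.Bool using (Bool; true; false; if_then_else_)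
  open import Data.Fin.Patterns using (0F; 1F; 2F)
  open import Data.List using ([]; _∷_; _++_; tabulate; cartesianProductWith)
  open import Data.List.Properties using (length-++; filter-++; filter-≐; map-++; map-∘; map-cong)
  open import Data.List.Relation.Unary.All using (All; all?)
  import Data.List.Relation.Unary.All as All
  open import Data.Nat using (_+_; _*_; _≤_; ∣_-_∣; _≡ᵇ_)
  open import Data.Nat.ListAction using (sum)
  open import Data.Nat.ListAction.Properties using (sum-++)
  open import Data.Nat.Solver using (module +-*-Solver)
  open import Data.Sum using (_⊎_; inj₁; inj₂)
  open import Relation.Nullary using (¬_; Dec; does; ¬?; _×-dec_; _⊎-dec_; contradiction)
  open import Relation.Nullary.Decidable using (does-⇔)
  open import Relation.Unary using (Pred; Decidable; _≐_)
  open import Algebra.Properties.CommutativeSemigroup ℕ.+-commutativeSemigroup using (x∙yz≈y∙xz; interchange)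
  open import Algebra.Properties.Semiring.Sum ℕ.+-*-semiring
    using (sum-syntax; sum-cong-≗; sum-replicate-zero; ∑-distrib-+; *-distribˡ-sum; *-distribʳ-sum)

  -- Counting the configurations that leave a space safe

  depth : ∀ {n} → Fin n → ℕ
  depth {n} x = toℕ x ⊓ (n ∸ suc (toℕ x))

  -- Choosing only entries that satisfy P is choosing from the filtered list. The induction follows
  -- `choose`: a head violating P starts no admissible sublist, and for a head satisfying P the two
  -- parts combine by Pascal's rule.
  length-filter-choose : ∀ {A : Set} {P : Pred A 0ℓ} (P? : Decidable P) k xs →
    length (filter (all? P?) (choose k xs)) ≡ length (filter P? xs) C k
  length-filter-choose P? zero    xs       = refl
  length-filter-choose P? (suc k) []       = refl
  length-filter-choose {A} P? (suc k) (x ∷ xs) = trans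
    (trans (cong length (filter-++ (all? P?) (map (x ∷_) (choose k xs)) (choose (suc k) xs)))
           (length-++ (filter (all? P?) (map (x ∷_) (choose k xs)))))
    split
    where
    extend : (Bs : List (List A)) → length (filter (all? P?) (map (x ∷_) Bs))
               ≡ (if does (P? x) then length (filter (all? P?) Bs) else 0)
    extend [] with does (P? x)
    ... | true  = refl
    ... | false = refl
    extend (B ∷ Bs) with does (P? x) | extend Bs
    ... | false | ih = ih
    ... | true  | ih with does (all? P? B)
    ...   | true  = cong suc ih
    ...   | false = ih

    split : length (filter (all? P?) (map (x ∷_) (choose k xs))) + length (filter (all? P?) (choose (suc k) xs))
              ≡ length (filter P? (x ∷ xs)) C suc k
    split rewrite extend (choose k xs) with does (P? x)
    ... | false = length-filter-choose P? (suc k) xs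
    ... | true  = trans (cong₂ _+_ (length-filter-choose P? k xs) (length-filter-choose P? (suc k) xs))
                        (nCk+nC[k+1]≡[n+1]C[k+1] (length (filter P? xs)) k)

  -- Double counting of the related pairs. For safety of spaces under configurations this is
  -- linearity of expectation.
  sum-length-filter-comm : ∀ {A B : Set} {R : A → B → Set} (R? : ∀ a b → Dec (R a b)) as bs →
    sum (map (λ a → length (filter (R? a) bs)) as) ≡ sum (map (λ b → length (filter (λ a → R? a b) as)) bs)
  sum-length-filter-comm {B = B} R? [] bs = zeros bs
    where
    zeros : (bs : List B) → 0 ≡ sum (map (λ _ → 0) bs)
    zeros []       = refl
    zeros (_ ∷ bs) = zeros bs
  sum-length-filter-comm {B = B} R? (a ∷ as) bs =
    trans (cong (length (filter (R? a) bs) +_) (sum-length-filter-comm R? as bs)) (add bs)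
    where
    add : (bs : List B) →
      length (filter (R? a) bs) + sum (map (λ b → length (filter (λ a → R? a b) as)) bs)
        ≡ sum (map (λ b → length (filter (λ a → R? a b) (a ∷ as))) bs)
    regroup : ∀ b bs →
      length (filter (R? a) bs) + sum (map (λ b → length (filter (λ a → R? a b) as)) (b ∷ bs))
        ≡ length (filter (λ a → R? a b) as) + sum (map (λ b → length (filter (λ a → R? a b) (a ∷ as))) bs)
    add []       = refl
    add (b ∷ bs) with does (R? a b)
    ... | true  = cong suc (regroup b bs)
    ... | false = regroup b bs
    regroup b bs = trans
      (x∙yz≈y∙xz (length (filter (R? a) bs)) (length (filter (λ a → R? a b) as))
                 (sum (map (λ b → length (filter (λ a → R? a b) as)) bs)))
      (cong (length (filter (λ a → R? a b) as) +_) (add bs))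

  -- A piece on x counts among the attackers of x, so `Safe≐` can express safety as a single
  -- condition on every piece.
  attacks-refl : ∀ {n} (x : Space n) → x Attacks x
  attacks-refl x = 0F , 1F , (λ ()) , trans (ℕ.∣n-n∣≡0 (toℕ (lookup x 0F))) (sym (ℕ.∣n-n∣≡0 (toℕ (lookup x 1F)))) , λ _ _ _ → refl

  Unattacking : ∀ {n} → Space n → Pred (Space n) 0ℓ
  Unattacking x a = ¬ (a Attacks x)

  unattacking? : ∀ {n} (x : Space n) → Decidable (Unattacking x)
  unattacking? x a = ¬? (a attacks? x)

  Safe≐ : ∀ {n} (x : Space n) → (λ B → Safe B x) ≐ All (Unattacking x)
  Safe≐ x = proj₂ , λ {B} all → (λ x∈B → All.lookup all x∈B (attacks-refl x)) , all

  sum-safeCount : ∀ n → sum (map safeCount (configurations n))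
    ≡ sum (map (λ x → length (filter (unattacking? x) (spaces n)) C (n ℕ.^ 2)) (spaces n))
  sum-safeCount n = trans
    (sum-length-filter-comm safe? (configurations n) (spaces n))
    (cong sum (map-cong (λ x → trans
      (cong length (filter-≐ (λ B → safe? B x) (all? (unattacking? x)) (Safe≐ x) (configurations n)))
      (length-filter-choose (unattacking? x) (n ℕ.^ 2) (spaces n))) (spaces n)))

  -- Sums over the board

  sum-map-product : ∀ {n m d} (f : Vec (Fin n) (suc d) → ℕ) (g : Fin m → Fin n) (vs : List (Vec (Fin n) d)) →
    sum (map f (cartesianProductWith _∷_ (tabulate g) vs)) ≡ ∑[ i < m ] sum (map (λ v → f (g i ∷ v)) vs)
  sum-map-product {m = zero}  f g vs = refl
  sum-map-product {m = suc m} f g vs = begin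
    sum (map f (map (g zero ∷_) vs ++ rest))           ≡⟨ cong sum (map-++ f (map (g zero ∷_) vs) rest) ⟩
    sum (map f (map (g zero ∷_) vs) ++ map f rest)     ≡⟨ sum-++ (map f (map (g zero ∷_) vs)) (map f rest) ⟩
    sum (map f (map (g zero ∷_) vs)) + sum (map f rest) ≡⟨ cong₂ _+_ (cong sum (sym (map-∘ vs))) (sum-map-product f (g ∘ suc) vs) ⟩
    ∑[ i < suc m ] sum (map (λ v → f (g i ∷ v)) vs)    ∎
    where
    open ≡-Reasoning
    rest = cartesianProductWith _∷_ (tabulate (g ∘ suc)) vs

  sum-spaces : ∀ n (f : Space n → ℕ) →
    sum (map f (spaces n)) ≡ ∑[ i < n ] ∑[ j < n ] ∑[ k < n ] f (i ∷ j ∷ k ∷ [])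
  sum-spaces n f = trans (sum-map-product f (λ i → i) (vecs n 2)) (sum-cong-≗ {n} λ i →
    trans (sum-map-product (f ∘ (i ∷_)) (λ j → j) (vecs n 1)) (sum-cong-≗ {n} λ j →
    trans (sum-map-product (f ∘ (i ∷_) ∘ (j ∷_)) (λ k → k) (vecs n 0)) (sum-cong-≗ {n} λ k → ℕ.+-identityʳ _)))

  -- Indicators and the attack relation in terms of distances

  𝟙 : Bool → ℕ
  𝟙 true  = 1
  𝟙 false = 0

  length-filter-¬ : ∀ {A : Set} {P : A → Set} (P? : ∀ x → Dec (P x)) xs →
    length (filter (λ x → ¬? (P? x)) xs) + sum (map (λ x → 𝟙 (does (P? x))) xs) ≡ length xs
  length-filter-¬ P? []       = refl
  length-filter-¬ P? (x ∷ xs) with does (P? x)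
  ... | true  = trans (ℕ.+-suc _ _) (cong suc (length-filter-¬ P? xs))
  ... | false = cong suc (length-filter-¬ P? xs)

  attackers : ∀ {n} → Space n → ℕ
  attackers {n} x = sum (map (λ a → 𝟙 (does (a attacks? x))) (spaces n))

  unattacking+attackers : ∀ {n} (x : Space n) →
    length (filter (unattacking? x) (spaces n)) + attackers x ≡ n ℕ.^ 3
  unattacking+attackers {n} x = trans (length-filter-¬ (_attacks? x) (spaces n)) (length-vecs n 3)

  -- The Kronecker delta. The Boolean test makes it compute on constructors and agree with
  -- `does (d ℕ.≟ e)` by definition, so sums over positive distances simplify by reduction.
  δ : ℕ → ℕ → ℕ
  δ d e = 𝟙 (d ≡ᵇ e)

  dist : ∀ {n} → Fin n → Fin n → ℕ
  dist x a = ∣ toℕ x - toℕ a ∣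

  dist≡0⇒≡ : ∀ {n} {x a : Fin n} → dist x a ≡ 0 → x ≡ a
  dist≡0⇒≡ eq = Fin.toℕ-injective (ℕ.∣m-n∣≡0⇒m≡n eq)

  ≡⇒dist≡0 : ∀ {n} {x a : Fin n} → x ≡ a → dist x a ≡ 0
  ≡⇒dist≡0 {x = x} refl = ℕ.∣n-n∣≡0 (toℕ x)

  -- One disjunct per axis-parallel plane, over unordered pairs of coordinates, in the form that
  -- inclusion-exclusion requires.
  InPlane : (d₀ d₁ d₂ : ℕ) → Set
  InPlane d₀ d₁ d₂ = (d₀ ≡ d₁ × d₂ ≡ 0) ⊎ (d₀ ≡ d₂ × d₁ ≡ 0) ⊎ (d₁ ≡ d₂ × d₀ ≡ 0)

  inPlane? : ∀ d₀ d₁ d₂ → Dec (InPlane d₀ d₁ d₂)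
  inPlane? d₀ d₁ d₂ =
    (d₀ ℕ.≟ d₁ ×-dec d₂ ℕ.≟ 0) ⊎-dec ((d₀ ℕ.≟ d₂ ×-dec d₁ ℕ.≟ 0) ⊎-dec (d₁ ℕ.≟ d₂ ×-dec d₀ ℕ.≟ 0))

  attacks⇔inPlane : ∀ {n} (a₀ a₁ a₂ x₀ x₁ x₂ : Fin n) →
    ((a₀ ∷ a₁ ∷ a₂ ∷ []) Attacks (x₀ ∷ x₁ ∷ x₂ ∷ [])) ⇔ InPlane (dist x₀ a₀) (dist x₁ a₁) (dist x₂ a₂)
  attacks⇔inPlane a₀ a₁ a₂ x₀ x₁ x₂ = mk⇔ to from
    where
    to : _ → InPlane (dist x₀ a₀) (dist x₁ a₁) (dist x₂ a₂)
    to (0F , 0F , i≢j , _)      = contradiction refl i≢j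
    to (1F , 1F , i≢j , _)      = contradiction refl i≢j
    to (2F , 2F , i≢j , _)      = contradiction refl i≢j
    to (0F , 1F , _ , eq , fix) = inj₁ (eq , ≡⇒dist≡0 (fix 2F (λ ()) (λ ())))
    to (1F , 0F , _ , eq , fix) = inj₁ (sym eq , ≡⇒dist≡0 (fix 2F (λ ()) (λ ())))
    to (0F , 2F , _ , eq , fix) = inj₂ (inj₁ (eq , ≡⇒dist≡0 (fix 1F (λ ()) (λ ()))))
    to (2F , 0F , _ , eq , fix) = inj₂ (inj₁ (sym eq , ≡⇒dist≡0 (fix 1F (λ ()) (λ ()))))
    to (1F , 2F , _ , eq , fix) = inj₂ (inj₂ (eq , ≡⇒dist≡0 (fix 0F (λ ()) (λ ()))))
    to (2F , 1F , _ , eq , fix) = inj₂ (inj₂ (sym eq , ≡⇒dist≡0 (fix 0F (λ ()) (λ ()))))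
    from : InPlane (dist x₀ a₀) (dist x₁ a₁) (dist x₂ a₂) → _
    from (inj₁ (eq , z)) = 0F , 1F , (λ ()) , eq , λ where
      0F k≢i _ → contradiction refl k≢i
      1F _ k≢j → contradiction refl k≢j
      2F _ _   → dist≡0⇒≡ z
    from (inj₂ (inj₁ (eq , z))) = 0F , 2F , (λ ()) , eq , λ where
      0F k≢i _ → contradiction refl k≢i
      1F _ _   → dist≡0⇒≡ z
      2F _ k≢j → contradiction refl k≢j
    from (inj₂ (inj₂ (eq , z))) = 1F , 2F , (λ ()) , eq , λ where
      0F _ _   → dist≡0⇒≡ z
      1F k≢i _ → contradiction refl k≢i
      2F _ k≢j → contradiction refl k≢j

  -- Any two of the three conditions in InPlane hold together only at the
  -- centre (0, 0, 0), where all three do.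
  inclusion-exclusion : ∀ d₀ d₁ d₂ →
    𝟙 (does (inPlane? d₀ d₁ d₂)) + 2 * (δ d₀ 0 * (δ d₁ 0 * δ d₂ 0))
      ≡ δ d₀ d₁ * δ d₂ 0 + δ d₀ d₂ * δ d₁ 0 + δ d₁ d₂ * δ d₀ 0
  inclusion-exclusion zero zero zero = refl
  inclusion-exclusion zero zero (suc _) = refl
  inclusion-exclusion zero (suc _) zero = refl
  inclusion-exclusion (suc _) zero zero = refl
  inclusion-exclusion zero (suc d₁) (suc d₂) with d₁ ≡ᵇ d₂
  ... | true  = refl
  ... | false = refl
  inclusion-exclusion (suc d₀) zero (suc d₂) with d₀ ≡ᵇ d₂
  ... | true  = refl
  ... | false = refl
  inclusion-exclusion (suc d₀) (suc d₁) zero with d₀ ≡ᵇ d₁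
  ... | true  = refl
  ... | false = refl
  inclusion-exclusion (suc d₀) (suc d₁) (suc d₂) with d₀ ≡ᵇ d₁ | d₀ ≡ᵇ d₂ | d₁ ≡ᵇ d₂
  ... | true  | true  | true  = refl
  ... | true  | true  | false = refl
  ... | true  | false | true  = refl
  ... | true  | false | false = refl
  ... | false | true  | true  = refl
  ... | false | true  | false = refl
  ... | false | false | true  = refl
  ... | false | false | false = refl

  -- Diagonals of a two-dimensional board

  ∑-zero : ∀ n {f : Fin n → ℕ} → (∀ i → f i ≡ 0) → ∑[ i < n ] f i ≡ 0
  ∑-zero n f≡0 = trans (sum-cong-≗ {n} f≡0) (sum-replicate-zero n)

  -- The row is split at x into x itself, its left side and its right side. In the induction the
  -- first space of the row has the largest distance on the left, hence `∑-snoc`.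
  ∑-dist : ∀ {n} (x : Fin n) (f : ℕ → ℕ) → ∑[ a < n ] f (dist x a)
    ≡ f 0 + ∑[ d < toℕ x ] f (suc (toℕ d)) + ∑[ d < n ∸ suc (toℕ x) ] f (suc (toℕ d))
  ∑-dist {suc n} zero    f = cong (_+ ∑[ d < n ] f (suc (toℕ d))) (sym (ℕ.+-identityʳ (f 0)))
  ∑-dist {suc n} (suc x) f = trans
    (cong (f (suc (toℕ x)) +_) (∑-dist x f))
    (trans (x∙yz≈y∙xz′ (f (suc (toℕ x))) (f 0) _ _)
           (cong (λ s → f 0 + s + ∑[ d < n ∸ suc (toℕ x) ] f (suc (toℕ d))) (∑-snoc (toℕ x) (f ∘ suc))))
    where
    x∙yz≈y∙xz′ : ∀ a b c d → a + (b + c + d) ≡ b + (c + a) + d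
    x∙yz≈y∙xz′ = solve 4 (λ a b c d → a :+ (b :+ c :+ d) := b :+ (c :+ a) :+ d) refl
      where open +-*-Solver
    ∑-snoc : ∀ m (g : ℕ → ℕ) → ∑[ d < m ] g (toℕ d) + g m ≡ ∑[ d < suc m ] g (toℕ d)
    ∑-snoc zero    g = ℕ.+-comm 0 (g 0)
    ∑-snoc (suc m) g = trans (ℕ.+-assoc (g 0) _ (g (suc m))) (cong (g 0 +_) (∑-snoc m (g ∘ suc)))

  -- Each of the four quadrants cut out by the row and the column through a space contains one
  -- diagonal arm, whose length is counted here.
  ∑∑-δ : ∀ k l → ∑[ d < k ] ∑[ e < l ] δ (toℕ d) (toℕ e) ≡ k ⊓ l
  ∑∑-δ zero    l       = refl
  ∑∑-δ (suc k) zero    = sum-replicate-zero k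
  ∑∑-δ (suc k) (suc l) = cong suc (cong₂ _+_ (∑-zero l λ _ → refl) (∑∑-δ k l))

  ∑-δ-dist-0 : ∀ {n} (x : Fin n) → ∑[ a < n ] δ (dist x a) 0 ≡ 1
  ∑-δ-dist-0 {n} x = trans (∑-dist x (λ d → δ d 0))
    (cong₂ _+_ (cong suc (∑-zero (toℕ x) λ _ → refl)) (∑-zero (n ∸ suc (toℕ x)) λ _ → refl))

  -- Equal sums and a ≤ b force a ≤ b ≤ b′ ≤ a′. The four minima are therefore a, a, b and b′, and a
  -- is the least of the four numbers.
  ⊓-corners-sorted : ∀ {a a′ b b′} → a ≤ a′ → b ≤ b′ → a ≤ b → a + a′ ≡ b + b′ →
    a ⊓ b + a ⊓ b′ + (a′ ⊓ b + a′ ⊓ b′) ≡ a + a′ + 2 * ((a ⊓ a′) ⊓ (b ⊓ b′))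
  ⊓-corners-sorted {a} {a′} {b} {b′} a≤a′ b≤b′ a≤b eq = begin
    a ⊓ b + a ⊓ b′ + (a′ ⊓ b + a′ ⊓ b′)
      ≡⟨ cong₂ _+_ (cong₂ _+_ (ℕ.m≤n⇒m⊓n≡m a≤b) (ℕ.m≤n⇒m⊓n≡m (ℕ.≤-trans a≤b b≤b′)))
                   (cong₂ _+_ (ℕ.m≥n⇒m⊓n≡n (ℕ.≤-trans b≤b′ b′≤a′)) (ℕ.m≥n⇒m⊓n≡n b′≤a′)) ⟩
    a + a + (b + b′)                             ≡⟨ cong (a + a +_) (sym eq) ⟩
    a + a + (a + a′)                             ≡⟨ regroup a a′ ⟩
    a + a′ + 2 * a                               ≡⟨ cong (λ m → a + a′ + 2 * m) (sym (ℕ.m≤n⇒m⊓n≡m a≤b)) ⟩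
    a + a′ + 2 * (a ⊓ b)                         ≡⟨ cong₂ (λ m k → a + a′ + 2 * (m ⊓ k)) (ℕ.m≤n⇒m⊓n≡m a≤a′) (ℕ.m≤n⇒m⊓n≡m b≤b′) ⟨
    a + a′ + 2 * ((a ⊓ a′) ⊓ (b ⊓ b′))           ∎
    where
    open ≡-Reasoning
    open +-*-Solver
    b′≤a′ : b′ ≤ a′
    b′≤a′ = ℕ.≮⇒≥ λ a′<b′ → ℕ.<-irrefl eq (ℕ.+-mono-≤-< a≤b a′<b′)
    regroup : ∀ a a′ → a + a + (a + a′) ≡ a + a′ + 2 * a
    regroup = solve 2 (λ a a′ → a :+ a :+ (a :+ a′) := a :+ a′ :+ con 2 :* a) refl

  ⊓-corners-≤ : ∀ a a′ b b′ → a ≤ a′ → b ≤ b′ → a + a′ ≡ b + b′ →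
    a ⊓ b + a ⊓ b′ + (a′ ⊓ b + a′ ⊓ b′) ≡ a + a′ + 2 * ((a ⊓ a′) ⊓ (b ⊓ b′))
  ⊓-corners-≤ a a′ b b′ a≤a′ b≤b′ eq with ℕ.≤-total a b
  ... | inj₁ a≤b = ⊓-corners-sorted a≤a′ b≤b′ a≤b eq
  ... | inj₂ b≤a rewrite eq | ℕ.⊓-comm a b | ℕ.⊓-comm a b′ | ℕ.⊓-comm a′ b | ℕ.⊓-comm a′ b′ | ℕ.⊓-comm (a ⊓ a′) (b ⊓ b′) =
    trans (interchange (b ⊓ a) (b′ ⊓ a) (b ⊓ a′) (b′ ⊓ a′)) (⊓-corners-sorted b≤b′ a≤a′ b≤a (sym eq))

  -- Here a, a′ and b, b′ count the spaces on either side of a space in two directions, and the four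
  -- minima are the lengths of its diagonal arms. Exchanging a with a′, b with b′ or the two pairs
  -- preserves the identity, which reduces it to the sorted case.
  ⊓-corners : ∀ a a′ b b′ → a + a′ ≡ b + b′ →
    a ⊓ b + a ⊓ b′ + (a′ ⊓ b + a′ ⊓ b′) ≡ a + a′ + 2 * ((a ⊓ a′) ⊓ (b ⊓ b′))
  ⊓-corners a a′ b b′ eq with ℕ.≤-total a a′ | ℕ.≤-total b b′
  ... | inj₁ a≤a′ | inj₁ b≤b′ = ⊓-corners-≤ a a′ b b′ a≤a′ b≤b′ eq
  ... | inj₁ a≤a′ | inj₂ b′≤b rewrite ℕ.⊓-comm b b′ | ℕ.+-comm (a ⊓ b) (a ⊓ b′) | ℕ.+-comm (a′ ⊓ b) (a′ ⊓ b′) =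
    ⊓-corners-≤ a a′ b′ b a≤a′ b′≤b (trans eq (ℕ.+-comm b b′))
  ... | inj₂ a′≤a | inj₁ b≤b′ rewrite ℕ.⊓-comm a a′ | ℕ.+-comm (a ⊓ b + a ⊓ b′) (a′ ⊓ b + a′ ⊓ b′) | ℕ.+-comm a a′ =
    ⊓-corners-≤ a′ a b b′ a′≤a b≤b′ eq
  ... | inj₂ a′≤a | inj₂ b′≤b rewrite ℕ.⊓-comm b b′ | ℕ.⊓-comm a a′ | ℕ.+-comm (a ⊓ b) (a ⊓ b′) | ℕ.+-comm (a′ ⊓ b) (a′ ⊓ b′)
                                    | ℕ.+-comm (a ⊓ b′ + a ⊓ b) (a′ ⊓ b′ + a′ ⊓ b) | ℕ.+-comm a a′ =
    ⊓-corners-≤ a′ a b′ b a′≤a b′≤b (trans eq (ℕ.+-comm b b′))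

  suc[toℕ+n∸suc]≡n : ∀ {n} (x : Fin n) → suc (toℕ x + (n ∸ suc (toℕ x))) ≡ n
  suc[toℕ+n∸suc]≡n x = ℕ.m+[n∸m]≡n (Fin.toℕ<n x)

  -- The number of spaces of the n × n board on the two diagonals through (x , y).
  diagonals : ∀ {n} → Fin n → Fin n → ℕ
  diagonals {n} x y = ∑[ a < n ] ∑[ b < n ] δ (dist x a) (dist y b)

  diagonals≡ : ∀ {n} (x y : Fin n) → diagonals x y ≡ n + 2 * (depth x ⊓ depth y)
  diagonals≡ {n} x y = begin
    diagonals x y
      ≡⟨ sum-cong-≗ {n} (λ a → ∑-dist y (δ (dist x a))) ⟩
    ∑[ a < n ] c (dist x a)
      ≡⟨ ∑-dist x c ⟩
    c 0 + ∑[ d < x₁ ] c (suc (toℕ d)) + ∑[ d < x₂ ] c (suc (toℕ d))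
      ≡⟨ cong₂ _+_ (cong₂ _+_ c0≡1 (∑-c x₁)) (∑-c x₂) ⟩
    suc (x₁ ⊓ y₁ + x₁ ⊓ y₂ + (x₂ ⊓ y₁ + x₂ ⊓ y₂))
      ≡⟨ cong suc (⊓-corners x₁ x₂ y₁ y₂ (ℕ.suc-injective (trans (suc[toℕ+n∸suc]≡n x) (sym (suc[toℕ+n∸suc]≡n y))))) ⟩
    suc (x₁ + x₂) + 2 * (depth x ⊓ depth y)
      ≡⟨ cong (_+ 2 * (depth x ⊓ depth y)) (suc[toℕ+n∸suc]≡n x) ⟩
    n + 2 * (depth x ⊓ depth y) ∎
    where
    open ≡-Reasoning
    x₁ x₂ y₁ y₂ : ℕ
    x₁ = toℕ x
    x₂ = n ∸ suc x₁
    y₁ = toℕ y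
    y₂ = n ∸ suc y₁
    -- `c d` is the number of coordinates at distance d from y, split by side.
    c : ℕ → ℕ
    c d = δ d 0 + ∑[ e < y₁ ] δ d (suc (toℕ e)) + ∑[ e < y₂ ] δ d (suc (toℕ e))
    c0≡1 : c 0 ≡ 1
    c0≡1 = cong₂ _+_ (cong suc (∑-zero y₁ λ _ → refl)) (∑-zero y₂ λ _ → refl)
    ∑-c : ∀ m → ∑[ d < m ] c (suc (toℕ d)) ≡ m ⊓ y₁ + m ⊓ y₂
    ∑-c m = trans (∑-distrib-+ {m} (λ d → ∑[ e < y₁ ] δ (toℕ d) (toℕ e)) (λ d → ∑[ e < y₂ ] δ (toℕ d) (toℕ e)))
                  (cong₂ _+_ (∑∑-δ m y₁) (∑∑-δ m y₂))

  -- The number of attackers of a space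

  ∑³ : ∀ n → (Fin n → Fin n → Fin n → ℕ) → ℕ
  ∑³ n f = ∑[ i < n ] ∑[ j < n ] ∑[ k < n ] f i j k

  ∑³-cong : ∀ n {f g : Fin n → Fin n → Fin n → ℕ} → (∀ i j k → f i j k ≡ g i j k) → ∑³ n f ≡ ∑³ n g
  ∑³-cong n f≡g = sum-cong-≗ {n} λ i → sum-cong-≗ {n} λ j → sum-cong-≗ {n} λ k → f≡g i j k

  ∑³-+ : ∀ n (f g : Fin n → Fin n → Fin n → ℕ) → ∑³ n (λ i j k → f i j k + g i j k) ≡ ∑³ n f + ∑³ n g
  ∑³-+ n f g = trans
    (sum-cong-≗ {n} λ i → trans
      (sum-cong-≗ {n} λ j → ∑-distrib-+ {n} (f i j) (g i j))
      (∑-distrib-+ {n} (λ j → ∑[ k < n ] f i j k) (λ j → ∑[ k < n ] g i j k)))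
    (∑-distrib-+ {n} (λ i → ∑[ j < n ] ∑[ k < n ] f i j k) (λ i → ∑[ j < n ] ∑[ k < n ] g i j k))

  ∑-*-one : ∀ n (c : ℕ) {f : Fin n → ℕ} → ∑[ i < n ] f i ≡ 1 → ∑[ i < n ] (c * f i) ≡ c
  ∑-*-one n c {f} f≡1 = trans (sym (*-distribˡ-sum {n} c f)) (trans (cong (c *_) f≡1) (ℕ.*-identityʳ c))

  module _ {n} (x₀ x₁ x₂ : Fin n) where

    -- The 2 is written as a sum over the board concentrated at x, so that `inclusion-exclusion`
    -- applies space by space. Each resulting product is a diagonal count in one plane times a sum
    -- over the third coordinate equal to 1.
    attackers+2 : attackers (x₀ ∷ x₁ ∷ x₂ ∷ []) + 2 ≡ diagonals x₀ x₁ + diagonals x₀ x₂ + diagonals x₁ x₂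
    attackers+2 = begin
      attackers (x₀ ∷ x₁ ∷ x₂ ∷ []) + 2
        ≡⟨ cong₂ _+_ (trans (sum-spaces n _) (∑³-cong n λ i j k →
             cong 𝟙 (does-⇔ (attacks⇔inPlane i j k x₀ x₁ x₂) ((i ∷ j ∷ k ∷ []) attacks? (x₀ ∷ x₁ ∷ x₂ ∷ [])) (inPlane? (d₀ i) (d₁ j) (d₂ k)))))
             (sym centre) ⟩
      ∑³ n (λ i j k → 𝟙 (does (inPlane? (d₀ i) (d₁ j) (d₂ k)))) + ∑³ n (λ i j k → 2 * (δ (d₀ i) 0 * (δ (d₁ j) 0 * δ (d₂ k) 0)))
        ≡⟨ ∑³-+ n _ _ ⟨
      ∑³ n (λ i j k → 𝟙 (does (inPlane? (d₀ i) (d₁ j) (d₂ k))) + 2 * (δ (d₀ i) 0 * (δ (d₁ j) 0 * δ (d₂ k) 0)))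
        ≡⟨ ∑³-cong n (λ i j k → inclusion-exclusion (d₀ i) (d₁ j) (d₂ k)) ⟩
      ∑³ n (λ i j k → δ (d₀ i) (d₁ j) * δ (d₂ k) 0 + δ (d₀ i) (d₂ k) * δ (d₁ j) 0 + δ (d₁ j) (d₂ k) * δ (d₀ i) 0)
        ≡⟨ trans (∑³-+ n _ _) (cong (_+ ∑³ n (λ i j k → δ (d₁ j) (d₂ k) * δ (d₀ i) 0)) (∑³-+ n _ _)) ⟩
      ∑³ n (λ i j k → δ (d₀ i) (d₁ j) * δ (d₂ k) 0) + ∑³ n (λ i j k → δ (d₀ i) (d₂ k) * δ (d₁ j) 0)
        + ∑³ n (λ i j k → δ (d₁ j) (d₂ k) * δ (d₀ i) 0)
        ≡⟨ cong₂ _+_ (cong₂ _+_ plane₀₁ plane₀₂) plane₁₂ ⟩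
      diagonals x₀ x₁ + diagonals x₀ x₂ + diagonals x₁ x₂ ∎
      where
      open ≡-Reasoning
      d₀ d₁ d₂ : Fin n → ℕ
      d₀ = dist x₀
      d₁ = dist x₁
      d₂ = dist x₂
      centre : ∑³ n (λ i j k → 2 * (δ (d₀ i) 0 * (δ (d₁ j) 0 * δ (d₂ k) 0))) ≡ 2
      centre = trans
        (sum-cong-≗ {n} λ i → trans
          (sum-cong-≗ {n} λ j → trans
            (sum-cong-≗ {n} λ k → reassoc (δ (d₀ i) 0) (δ (d₁ j) 0) (δ (d₂ k) 0))
            (∑-*-one n _ (∑-δ-dist-0 x₂)))
          (∑-*-one n _ (∑-δ-dist-0 x₁)))
        (∑-*-one n 2 (∑-δ-dist-0 x₀))
        where
        reassoc : ∀ a b c → 2 * (a * (b * c)) ≡ 2 * a * b * c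
        reassoc = solve 3 (λ a b c → con 2 :* (a :* (b :* c)) := con 2 :* a :* b :* c) refl
          where open +-*-Solver
      plane₀₁ : ∑³ n (λ i j k → δ (d₀ i) (d₁ j) * δ (d₂ k) 0) ≡ diagonals x₀ x₁
      plane₀₁ = sum-cong-≗ {n} λ i → sum-cong-≗ {n} λ j → ∑-*-one n _ (∑-δ-dist-0 x₂)
      plane₀₂ : ∑³ n (λ i j k → δ (d₀ i) (d₂ k) * δ (d₁ j) 0) ≡ diagonals x₀ x₂
      plane₀₂ = sum-cong-≗ {n} λ i → trans
        (sum-cong-≗ {n} λ j → sym (*-distribʳ-sum {n} (δ (d₁ j) 0) (λ k → δ (d₀ i) (d₂ k))))
        (∑-*-one n _ (∑-δ-dist-0 x₁))
      plane₁₂ : ∑³ n (λ i j k → δ (d₁ j) (d₂ k) * δ (d₀ i) 0) ≡ diagonals x₁ x₂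
      plane₁₂ = trans
        (sum-cong-≗ {n} λ i → trans
          (sum-cong-≗ {n} λ j → sym (*-distribʳ-sum {n} (δ (d₀ i) 0) (λ k → δ (d₁ j) (d₂ k))))
          (sym (*-distribʳ-sum {n} (δ (d₀ i) 0) (λ j → ∑[ k < n ] δ (d₁ j) (d₂ k)))))
        (∑-*-one n _ (∑-δ-dist-0 x₀))

    exponent : ℕ
    exponent = depth x₀ ⊓ depth x₁ + depth x₀ ⊓ depth x₂ + depth x₁ ⊓ depth x₂

    attackers+2≡ : attackers (x₀ ∷ x₁ ∷ x₂ ∷ []) + 2 ≡ n * 3 + 2 * exponent
    attackers+2≡ = trans attackers+2 (trans
      (cong₂ _+_ (cong₂ _+_ (diagonals≡ x₀ x₁) (diagonals≡ x₀ x₂)) (diagonals≡ x₁ x₂))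
      (regroup n (depth x₀ ⊓ depth x₁) (depth x₀ ⊓ depth x₂) (depth x₁ ⊓ depth x₂)))
      where
      regroup : ∀ n a b c → n + 2 * a + (n + 2 * b) + (n + 2 * c) ≡ n * 3 + 2 * (a + b + c)
      regroup = solve 4 (λ n a b c → n :+ con 2 :* a :+ (n :+ con 2 :* b) :+ (n :+ con 2 :* c)
                                       := n :* con 3 :+ con 2 :* (a :+ b :+ c)) refl
        where open +-*-Solver

  2*depth≤n : ∀ {n} (x : Fin n) → 2 * depth x ≤ n
  2*depth≤n {n} x = ℕ.≤-trans
    (ℕ.+-mono-≤ (ℕ.m⊓n≤m (toℕ x) x₂) (ℕ.≤-trans (ℕ.≤-reflexive (ℕ.+-identityʳ (depth x))) (ℕ.m⊓n≤n (toℕ x) x₂)))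
    (ℕ.≤-trans (ℕ.n≤1+n (toℕ x + x₂)) (ℕ.≤-reflexive (suc[toℕ+n∸suc]≡n x)))
    where x₂ = n ∸ suc (toℕ x)

  -- Depths are at most n/2, so each of the three minima adds at most n to 3n. Linearity in n is
  -- what makes the accumulated error of `ρ-approx` of order p.
  attackers≤ : ∀ {n} (x₀ x₁ x₂ : Fin n) → attackers (x₀ ∷ x₁ ∷ x₂ ∷ []) ≤ n * 6
  attackers≤ {n} x₀ x₁ x₂ = begin
    attackers (x₀ ∷ x₁ ∷ x₂ ∷ [])       ≤⟨ ℕ.m≤m+n _ 2 ⟩
    attackers (x₀ ∷ x₁ ∷ x₂ ∷ []) + 2   ≡⟨ attackers+2≡ x₀ x₁ x₂ ⟩
    n * 3 + 2 * exponent x₀ x₁ x₂       ≡⟨ cong (n * 3 +_) (expand (depth x₀ ⊓ depth x₁) _ _) ⟩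
    n * 3 + (2 * (depth x₀ ⊓ depth x₁) + 2 * (depth x₀ ⊓ depth x₂) + 2 * (depth x₁ ⊓ depth x₂))
                                        ≤⟨ ℕ.+-monoʳ-≤ (n * 3) (ℕ.+-mono-≤ (ℕ.+-mono-≤ (bound x₀ x₁) (bound x₀ x₂)) (bound x₁ x₂)) ⟩
    n * 3 + (n + n + n)                 ≡⟨ collect n ⟩
    n * 6                               ∎
    where
    open ℕ.≤-Reasoning
    bound : ∀ x y → 2 * (depth x ⊓ depth y) ≤ n
    bound x y = ℕ.≤-trans (ℕ.*-monoʳ-≤ 2 (ℕ.m⊓n≤m (depth x) (depth y))) (2*depth≤n x)
    open +-*-Solver
    expand : ∀ a b c → 2 * (a + b + c) ≡ 2 * a + 2 * b + 2 * c
    expand = solve 3 (λ a b c → con 2 :* (a :+ b :+ c) := con 2 :* a :+ con 2 :* b :+ con 2 :* c) refl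
    collect : ∀ n → n * 3 + (n + n + n) ≡ n * 6
    collect = solve 1 (λ n → n :* con 3 :+ (n :+ n :+ n) := n :* con 6) refl

open Counting using (depth; unattacking?; sum-safeCount; sum-spaces; attackers; unattacking+attackers;
                     exponent; attackers+2≡; attackers≤)
open import Data.Integer using (+_)
import Data.Integer as ℤ
import Data.Integer.Properties as ℤ
open import Data.Rational using (ℚ; 0ℚ; 1ℚ; ½; _/_; 1/_; _+_; _*_; _-_; -_; ∣_∣; _≤_; _<_)
import Data.Rational as ℚ
import Data.Rational.Properties as ℚ
import Data.Rational.Unnormalised as ℚᵘ
import Data.Rational.Unnormalised.Properties as ℚᵘ
open import Data.Rational.Solver using (module +-*-Solver)
open import Algebra.Bundles using (CommutativeRing)
open import Algebra.Properties.Semiring.Exp (CommutativeRing.semiring ℚ.+-*-commutativeRing)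
  using (_^_; ^-homo-*; ^-assocʳ)
open import Algebra.Properties.Semiring.Sum (CommutativeRing.semiring ℚ.+-*-commutativeRing)
  using (sum-syntax; sum-cong-≗; ∑-distrib-+; *-distribˡ-sum; sum-init-last)
import Algebra.Properties.Semiring.Sum ℕ.+-*-semiring as ∑ℕ

-- Arithmetic of rational numbers

-- The embedding is opaque because the unifier would otherwise unfold it to the
-- normalisation of fractions.
opaque
  ι : ℕ → ℚ
  ι n = + n / 1

  ι≡/1 : ∀ n → ι n ≡ + n / 1
  ι≡/1 n = refl

  toℚᵘ-ι : ∀ n → ℚ.toℚᵘ (ι n) ℚᵘ.≃ ℚᵘ.mkℚᵘ (+ n) 0
  toℚᵘ-ι n = ℚ.toℚᵘ-fromℚᵘ (ℚᵘ.mkℚᵘ (+ n) 0)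

  0≤ι : ∀ n → 0ℚ ≤ ι n
  0≤ι n = ℚ.nonNegative⁻¹ (ι n) ⦃ ℚ.normalize-nonNeg n 1 ⦄

ι-+ : ∀ m n → ι (m ℕ.+ n) ≡ ι m + ι n
ι-+ m n = ℚ.toℚᵘ-injective (begin
  ℚ.toℚᵘ (ι (m ℕ.+ n))                   ≈⟨ toℚᵘ-ι (m ℕ.+ n) ⟩
  ℚᵘ.mkℚᵘ (+ (m ℕ.+ n)) 0                ≈⟨ ℚᵘ.*≡* (cong (ℤ._* + 1)
                                              (sym (cong₂ ℤ._+_ (ℤ.*-identityʳ (+ m)) (ℤ.*-identityʳ (+ n))))) ⟩
  ℚᵘ.mkℚᵘ (+ m) 0 ℚᵘ.+ ℚᵘ.mkℚᵘ (+ n) 0   ≈⟨ ℚᵘ.+-cong (toℚᵘ-ι m) (toℚᵘ-ι n) ⟨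
  ℚ.toℚᵘ (ι m) ℚᵘ.+ ℚ.toℚᵘ (ι n)         ≈⟨ ℚ.toℚᵘ-homo-+ (ι m) (ι n) ⟨
  ℚ.toℚᵘ (ι m + ι n)                     ∎)
  where open ℚᵘ.≃-Reasoning

ι-* : ∀ m n → ι (m ℕ.* n) ≡ ι m * ι n
ι-* m n = ℚ.toℚᵘ-injective (begin
  ℚ.toℚᵘ (ι (m ℕ.* n))                   ≈⟨ toℚᵘ-ι (m ℕ.* n) ⟩
  ℚᵘ.mkℚᵘ (+ (m ℕ.* n)) 0                ≈⟨ ℚᵘ.*≡* (cong (ℤ._* + 1) (ℤ.pos-* m n)) ⟩
  ℚᵘ.mkℚᵘ (+ m) 0 ℚᵘ.* ℚᵘ.mkℚᵘ (+ n) 0   ≈⟨ ℚᵘ.*-cong (toℚᵘ-ι m) (toℚᵘ-ι n) ⟨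
  ℚ.toℚᵘ (ι m) ℚᵘ.* ℚ.toℚᵘ (ι n)         ≈⟨ ℚ.toℚᵘ-homo-* (ι m) (ι n) ⟨
  ℚ.toℚᵘ (ι m * ι n)                     ∎)
  where open ℚᵘ.≃-Reasoning

ι-0 : ι 0 ≡ 0ℚ
ι-0 = ι≡/1 0

ι-1 : ι 1 ≡ 1ℚ
ι-1 = ι≡/1 1

ι-suc : ∀ n → ι (suc n) ≡ 1ℚ + ι n
ι-suc n = trans (ι-+ 1 n) (cong (_+ ι n) ι-1)

ι-mono-≤ : ∀ {m n} → m ℕ.≤ n → ι m ≤ ι n
ι-mono-≤ {m} m≤n = subst (λ k → ι m ≤ ι k) (ℕ.m+[n∸m]≡n m≤n)
  (subst (ι m ≤_) (sym (ι-+ m _)) (≤-+ʳ (ι m) (0≤ι _)))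

/-*-ι : ∀ m n .⦃ _ : NonZero n ⦄ → + m / n * ι n ≡ ι m
/-*-ι m (suc n) = ℚ.toℚᵘ-injective (begin
  ℚ.toℚᵘ (+ m / suc n * ι (suc n))                  ≈⟨ ℚ.toℚᵘ-homo-* (+ m / suc n) (ι (suc n)) ⟩
  ℚ.toℚᵘ (+ m / suc n) ℚᵘ.* ℚ.toℚᵘ (ι (suc n))      ≈⟨ ℚᵘ.*-cong (ℚ.toℚᵘ-fromℚᵘ (ℚᵘ.mkℚᵘ (+ m) n)) (toℚᵘ-ι (suc n)) ⟩
  ℚᵘ.mkℚᵘ (+ m) n ℚᵘ.* ℚᵘ.mkℚᵘ (+ suc n) 0          ≈⟨ ℚᵘ.*≡* (trans (ℤ.*-identityʳ _)
                                                         (cong (λ k → + m ℤ.* + suc k) (sym (ℕ.*-identityʳ n)))) ⟩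
  ℚᵘ.mkℚᵘ (+ m) 0                                   ≈⟨ toℚᵘ-ι m ⟨
  ℚ.toℚᵘ (ι m)                                      ∎)
  where open ℚᵘ.≃-Reasoning

0≤+ : ∀ {x y} → 0ℚ ≤ x → 0ℚ ≤ y → 0ℚ ≤ x + y
0≤+ 0≤x 0≤y = ℚ.+-mono-≤ 0≤x 0≤y

0≤* : ∀ {x y} → 0ℚ ≤ x → 0ℚ ≤ y → 0ℚ ≤ x * y
0≤* {x} {y} 0≤x 0≤y = subst (_≤ x * y) (ℚ.*-zeroˡ 0ℚ) (*-mono ℚ.≤-refl 0≤x 0≤x 0≤y)

0≤^ : ∀ {x} → 0ℚ ≤ x → ∀ n → 0ℚ ≤ x ^ n
0≤^ 0≤x zero    = ℚ.nonNegative⁻¹ 1ℚ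
0≤^ 0≤x (suc n) = 0≤* 0≤x (0≤^ 0≤x n)

x≤y⇒0≤y-x : ∀ {x y} → x ≤ y → 0ℚ ≤ y - x
x≤y⇒0≤y-x {x} {y} x≤y = subst (_≤ y - x) (ℚ.+-inverseʳ x) (ℚ.+-monoˡ-≤ (- x) x≤y)

-- Reduces an inequality to an explicit nonnegative difference and an identity that the ring solver
-- can check.
≤-by : ∀ {x y d} → 0ℚ ≤ d → x + d ≡ y → x ≤ y
≤-by {x} 0≤d eq = subst (x ≤_) eq (≤-+ʳ x 0≤d)

1^ : ∀ n → 1ℚ ^ n ≡ 1ℚ
1^ zero    = refl
1^ (suc n) = trans (ℚ.*-identityˡ _) (1^ n)

*-^ : ∀ x y n → (x * y) ^ n ≡ x ^ n * y ^ n
*-^ x y zero    = refl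
*-^ x y (suc n) = trans (cong (x * y *_) (*-^ x y n)) (interchange x y (x ^ n) (y ^ n))
  where
  open +-*-Solver
  interchange : ∀ a b c d → a * b * (c * d) ≡ a * c * (b * d)
  interchange = solve 4 (λ a b c d → a :* b :* (c :* d) := a :* c :* (b :* d)) refl

-- This and the following bounds compose along the structure of a polynomial, so its bound is
-- computed from bounds on its variables and the absolute values of its coefficients.
∣∣≤-+ : ∀ {x y A B} → ∣ x ∣ ≤ A → ∣ y ∣ ≤ B → ∣ x + y ∣ ≤ A + B
∣∣≤-+ {x} {y} x≤ y≤ = ℚ.≤-trans (ℚ.∣p+q∣≤∣p∣+∣q∣ x y) (ℚ.+-mono-≤ x≤ y≤)

∣∣≤-- : ∀ {x y A B} → ∣ x ∣ ≤ A → ∣ y ∣ ≤ B → ∣ x - y ∣ ≤ A + B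
∣∣≤-- {x} {y} x≤ y≤ = ℚ.≤-trans (ℚ.∣p-q∣≤∣p∣+∣q∣ x y) (ℚ.+-mono-≤ x≤ y≤)

∣∣≤-* : ∀ {x y A B} → ∣ x ∣ ≤ A → ∣ y ∣ ≤ B → ∣ x * y ∣ ≤ A * B
∣∣≤-* {x} {y} x≤ y≤ = subst (_≤ _) (sym (ℚ.∣p*q∣≡∣p∣*∣q∣ x y))
  (*-mono (ℚ.0≤∣p∣ y) (ℚ.≤-trans (ℚ.0≤∣p∣ x) x≤) x≤ y≤)

∣∣≤-self : ∀ {x} → 0ℚ ≤ x → ∣ x ∣ ≤ x
∣∣≤-self 0≤x = ℚ.≤-reflexive (ℚ.0≤p⇒∣p∣≡p 0≤x)

∣∣≤-nonNeg : ∀ {x A} → 0ℚ ≤ x → x ≤ A → ∣ x ∣ ≤ A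
∣∣≤-nonNeg 0≤x x≤A = ℚ.≤-trans (∣∣≤-self 0≤x) x≤A

∣∣≤-^ : ∀ {x} → ∣ x ∣ ≤ 1ℚ → ∀ n → ∣ x ^ n ∣ ≤ 1ℚ
∣∣≤-^ x≤ zero    = ℚ.≤-refl
∣∣≤-^ {x} x≤ (suc n) = subst (∣ x * x ^ n ∣ ≤_) (ℚ.*-identityˡ 1ℚ) (∣∣≤-* x≤ (∣∣≤-^ x≤ n))

∣-∣≤-trans : ∀ {x z A B} y → ∣ x - y ∣ ≤ A → ∣ y - z ∣ ≤ B → ∣ x - z ∣ ≤ A + B
∣-∣≤-trans {x} {z} {A} {B} y xy yz = subst (λ w → ∣ w ∣ ≤ A + B) (telescope x y z) (∣∣≤-+ xy yz)
  where
  open +-*-Solver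
  telescope : ∀ x y z → (x - y) + (y - z) ≡ x - z
  telescope = solve 3 (λ x y z → (x :- y) :+ (y :- z) := x :- z) refl

-- (1 - 1/n)^n and the exponential series

ι-suc-*-1/! : ∀ j → ι (suc j) * 1/! suc j ≡ 1/! j
ι-suc-*-1/! j = begin
  ι (suc j) * 1/! suc j                          ≡⟨ ℚ.*-identityʳ _ ⟨
  ι (suc j) * 1/! suc j * 1ℚ                     ≡⟨ cong (ι (suc j) * 1/! suc j *_) (trans (sym ι-1) (sym 1/!*!)) ⟩
  ι (suc j) * 1/! suc j * (1/! j * ι (j !))      ≡⟨ regroup (ι (suc j)) (1/! suc j) (1/! j) (ι (j !)) ⟩
  1/! suc j * (ι (suc j) * ι (j !)) * 1/! j      ≡⟨ cong (λ x → 1/! suc j * x * 1/! j) (ι-* (suc j) (j !)) ⟨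
  1/! suc j * ι (suc j !) * 1/! j                ≡⟨ cong (_* 1/! j) (trans (/-*-ι 1 (suc j !) ⦃ suc j ℕ.!≢0 ⦄) ι-1) ⟩
  1ℚ * 1/! j                                     ≡⟨ ℚ.*-identityˡ _ ⟩
  1/! j                                          ∎
  where
  open ≡-Reasoning
  open +-*-Solver
  1/!*! : 1/! j * ι (j !) ≡ ι 1
  1/!*! = /-*-ι 1 (j !) ⦃ j ℕ.!≢0 ⦄
  regroup : ∀ a b c d → a * b * (c * d) ≡ b * (a * d) * c
  regroup = solve 4 (λ a b c d → a :* b :* (c :* d) := b :* (a :* d) :* c) refl

-- t ↦ t^(j+1) is convex, so its increment over [t , t + h] lies between h
-- times its derivatives at both ends.
module _ {t h} (0≤t : 0ℚ ≤ t) (0≤h : 0ℚ ≤ h) where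

  0≤t+h : 0ℚ ≤ t + h
  0≤t+h = 0≤+ 0≤t 0≤h

  ^-increment-upper : ∀ j → (t + h) ^ suc j ≤ t ^ suc j + ι (suc j) * (h * (t + h) ^ j)
  ^-increment-upper zero    = ℚ.≤-reflexive
    (trans (identity t h) (cong (λ i → t * 1ℚ + i * (h * 1ℚ)) (sym ι-1)))
    where
    open +-*-Solver
    identity : ∀ t h → (t + h) * 1ℚ ≡ t * 1ℚ + 1ℚ * (h * 1ℚ)
    identity = solve 2 (λ t h → (t :+ h) :* con 1ℚ := t :* con 1ℚ :+ con 1ℚ :* (h :* con 1ℚ)) refl
  ^-increment-upper (suc j) = ≤-by
    (0≤+ (0≤* 0≤t (x≤y⇒0≤y-x (^-increment-upper j)))
         (0≤* (0≤ι (suc j)) (0≤* 0≤h (0≤* 0≤h (0≤^ 0≤t+h j)))))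
    (trans (identity t h (t ^ j) ((t + h) ^ j) (ι (suc j)))
           (cong (λ i → t ^ suc (suc j) + i * (h * (t + h) ^ suc j)) (sym (ι-suc (suc j)))))
    where
    open +-*-Solver
    identity : ∀ t h x y i →
      (t + h) * ((t + h) * y) + (t * ((t * x + i * (h * y)) - (t + h) * y) + i * (h * (h * y)))
        ≡ t * (t * x) + (1ℚ + i) * (h * ((t + h) * y))
    identity = solve 5 (λ t h x y i →
      (t :+ h) :* ((t :+ h) :* y) :+ (t :* ((t :* x :+ i :* (h :* y)) :- (t :+ h) :* y) :+ i :* (h :* (h :* y)))
        := t :* (t :* x) :+ (con 1ℚ :+ i) :* (h :* ((t :+ h) :* y))) refl

  ^-increment-lower : ∀ j → t ^ suc j + ι (suc j) * (h * t ^ j) ≤ (t + h) ^ suc j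
  ^-increment-lower zero    = ℚ.≤-reflexive
    (trans (cong (λ i → t * 1ℚ + i * (h * 1ℚ)) ι-1) (identity t h))
    where
    open +-*-Solver
    identity : ∀ t h → t * 1ℚ + 1ℚ * (h * 1ℚ) ≡ (t + h) * 1ℚ
    identity = solve 2 (λ t h → t :* con 1ℚ :+ con 1ℚ :* (h :* con 1ℚ) := (t :+ h) :* con 1ℚ) refl
  ^-increment-lower (suc j) = ≤-by
    (0≤+ (0≤* 0≤t+h (x≤y⇒0≤y-x (^-increment-lower j)))
         (0≤* (0≤ι (suc j)) (0≤* 0≤h (0≤* 0≤h (0≤^ 0≤t j)))))
    (trans (cong (λ i → t ^ suc (suc j) + i * (h * t ^ suc j)
                      + ((t + h) * ((t + h) ^ suc j - (t ^ suc j + ι (suc j) * (h * t ^ j)))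
                        + ι (suc j) * (h * (h * t ^ j)))) (ι-suc (suc j)))
           (identity t h (t ^ j) ((t + h) ^ j) (ι (suc j))))
    where
    open +-*-Solver
    identity : ∀ t h x y i →
      t * (t * x) + (1ℚ + i) * (h * (t * x))
        + ((t + h) * ((t + h) * y - (t * x + i * (h * x))) + i * (h * (h * x)))
        ≡ (t + h) * ((t + h) * y)
    identity = solve 5 (λ t h x y i →
      t :* (t :* x) :+ (con 1ℚ :+ i) :* (h :* (t :* x))
        :+ ((t :+ h) :* ((t :+ h) :* y :- (t :* x :+ i :* (h :* x))) :+ i :* (h :* (h :* x)))
        := (t :+ h) :* ((t :+ h) :* y)) refl

-- Taylor polynomials of the exponential function

expSum : ℕ → ℚ → ℚ
expSum zero    t = 1/! 0
expSum (suc k) t = expSum k t + t ^ suc k * 1/! suc k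

expSum-0 : ∀ k → expSum k 0ℚ ≡ 1ℚ
expSum-0 zero    = refl
expSum-0 (suc k) = trans
  (cong₂ _+_ (expSum-0 k)
    (trans (cong (_* 1/! suc k) (ℚ.*-zeroˡ (0ℚ ^ k))) (ℚ.*-zeroˡ (1/! suc k))))
  (ℚ.+-identityʳ 1ℚ)

expSum-1 : ∀ k → expSum k 1ℚ ≡ eSum k
expSum-1 zero    = refl
expSum-1 (suc k) = cong₂ _+_ (expSum-1 k)
  (trans (cong (_* 1/! suc k) (1^ (suc k))) (ℚ.*-identityˡ (1/! suc k)))

ι-suc-*-/! : ∀ j h x → ι (suc j) * (h * x) * 1/! suc j ≡ h * (x * 1/! j)
ι-suc-*-/! j h x = trans (regroup (ι (suc j)) h x (1/! suc j)) (cong (λ i → h * (x * i)) (ι-suc-*-1/! j))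
  where
  open +-*-Solver
  regroup : ∀ a b c d → a * (b * c) * d ≡ b * (c * (a * d))
  regroup = solve 4 (λ a b c d → a :* (b :* c) :* d := b :* (c :* (a :* d))) refl

module _ {t h} (0≤t : 0ℚ ≤ t) (0≤h : 0ℚ ≤ h) where

  term-increment-upper : ∀ j →
    (t + h) ^ suc j * 1/! suc j ≤ t ^ suc j * 1/! suc j + h * ((t + h) ^ j * 1/! j)
  term-increment-upper j = subst ((t + h) ^ suc j * 1/! suc j ≤_)
    (trans (ℚ.*-distribʳ-+ (1/! suc j) (t ^ suc j) (ι (suc j) * (h * (t + h) ^ j)))
           (cong (_+_ (t ^ suc j * 1/! suc j)) (ι-suc-*-/! j h ((t + h) ^ j))))
    (ℚ.*-monoʳ-≤-nonNeg (1/! suc j) ⦃ ℚ.nonNegative (1/!-nonNeg (suc j)) ⦄ (^-increment-upper 0≤t 0≤h j))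

  term-increment-lower : ∀ j →
    t ^ suc j * 1/! suc j + h * (t ^ j * 1/! j) ≤ (t + h) ^ suc j * 1/! suc j
  term-increment-lower j = subst (_≤ (t + h) ^ suc j * 1/! suc j)
    (trans (ℚ.*-distribʳ-+ (1/! suc j) (t ^ suc j) (ι (suc j) * (h * t ^ j)))
           (cong (_+_ (t ^ suc j * 1/! suc j)) (ι-suc-*-/! j h (t ^ j))))
    (ℚ.*-monoʳ-≤-nonNeg (1/! suc j) ⦃ ℚ.nonNegative (1/!-nonNeg (suc j)) ⦄ (^-increment-lower 0≤t 0≤h j))

  -- The derivative of `expSum k` is `expSum k` without its top term. Adding h times that term on
  -- the left lets the termwise bounds add up by induction.
  expSum-increment-upper : ∀ k → expSum k (t + h) + h * ((t + h) ^ k * 1/! k) ≤ expSum k t + h * expSum k (t + h)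
  expSum-increment-upper zero    = ℚ.≤-reflexive (cong (λ x → 1/! 0 + h * x) (ℚ.*-identityˡ 1ℚ))
  expSum-increment-upper (suc k) = ≤-by
    (0≤+ (x≤y⇒0≤y-x (expSum-increment-upper k)) (x≤y⇒0≤y-x (term-increment-upper k)))
    (identity (expSum k t) (expSum k (t + h)) (t ^ suc k * 1/! suc k) ((t + h) ^ suc k * 1/! suc k)
              ((t + h) ^ k * 1/! k) h)
    where
    open +-*-Solver
    identity : ∀ e e′ x y z h →
      e′ + y + h * y + (((e + h * e′) - (e′ + h * z)) + ((x + h * z) - y))
        ≡ e + x + h * (e′ + y)
    identity = solve 6 (λ e e′ x y z h →
      e′ :+ y :+ h :* y :+ (((e :+ h :* e′) :- (e′ :+ h :* z)) :+ ((x :+ h :* z) :- y))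
        := e :+ x :+ h :* (e′ :+ y)) refl

  -- Convexity again, with the derivative of `expSum (suc k)` at the left end, which is
  -- `expSum k t`.
  expSum-increment-lower : ∀ k → expSum (suc k) t + h * expSum k t ≤ expSum (suc k) (t + h)
  expSum-increment-lower zero    = subst (_≤ 1/! 0 + (t + h) ^ 1 * 1/! 1)
    (trans (sym (ℚ.+-assoc (1/! 0) (t ^ 1 * 1/! 1) (h * (1ℚ * 1/! 0))))
           (cong (λ x → 1/! 0 + t ^ 1 * 1/! 1 + h * x) (ℚ.*-identityˡ 1ℚ)))
    (ℚ.+-monoʳ-≤ (1/! 0) (term-increment-lower zero))
  expSum-increment-lower (suc k) = subst (_≤ expSum (suc (suc k)) (t + h))
    (identity (expSum (suc k) t) (expSum k t) (t ^ suc (suc k) * 1/! suc (suc k)) (t ^ suc k * 1/! suc k) h)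
    (ℚ.+-mono-≤ (expSum-increment-lower k) (term-increment-lower (suc k)))
    where
    open +-*-Solver
    identity : ∀ e e′ x y h → e + h * e′ + (x + h * y) ≡ e + x + h * (e′ + y)
    identity = solve 5 (λ e e′ x y h → e :+ h :* e′ :+ (x :+ h :* y) := e :+ x :+ h :* (e′ :+ y)) refl

expSum-suc : ∀ {t} → 0ℚ ≤ t → ∀ k → expSum k t ≤ expSum (suc k) t
expSum-suc {t} 0≤t k = ≤-+ʳ (expSum k t) (0≤* (0≤^ 0≤t (suc k)) (1/!-nonNeg (suc k)))

ι-suc-* : ∀ m h → ι (suc m) * h ≡ ι m * h + h
ι-suc-* m h = trans (cong (_* h) (ι-suc m)) (identity (ι m) h)
  where
  open +-*-Solver
  identity : ∀ a h → (1ℚ + a) * h ≡ a * h + h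
  identity = solve 2 (λ a h → (con 1ℚ :+ a) :* h := a :* h :+ h) refl

-- The discrete form of exp(-t) · exp(t) ≤ 1: by `expSum-increment-upper`, multiplying
-- `expSum k (t + h)` by 1 - h gives at most `expSum k t`, so the product does not increase with m.
expSum-*-[1-h]^ : ∀ {h} → 0ℚ ≤ h → h ≤ 1ℚ → ∀ k m → (1ℚ - h) ^ m * expSum k (ι m * h) ≤ 1ℚ
expSum-*-[1-h]^ {h} 0≤h h≤1 k zero    = ℚ.≤-reflexive
  (trans (ℚ.*-identityˡ _) (trans (cong (expSum k) (trans (cong (_* h) ι-0) (ℚ.*-zeroˡ h))) (expSum-0 k)))
expSum-*-[1-h]^ {h} 0≤h h≤1 k (suc m) = ℚ.≤-trans
  (subst₂ _≤_
    (trans (identity (expSum k (t + h)) h ((1ℚ - h) ^ m))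
           (cong (λ u → (1ℚ - h) ^ suc m * expSum k u) (sym (ι-suc-* m h))))
    refl
    (ℚ.*-monoˡ-≤-nonNeg ((1ℚ - h) ^ m) ⦃ ℚ.nonNegative (0≤^ (x≤y⇒0≤y-x h≤1) m) ⦄
      (p≤q+r⇒p-r≤q (ℚ.≤-trans
        (≤-+ʳ (expSum k (t + h)) (0≤* 0≤h (0≤* (0≤^ (0≤+ 0≤t 0≤h) k) (1/!-nonNeg k))))
        (expSum-increment-upper 0≤t 0≤h k)))))
  (expSum-*-[1-h]^ 0≤h h≤1 k m)
  where
  t = ι m * h
  0≤t : 0ℚ ≤ t
  0≤t = 0≤* (0≤ι m) 0≤h
  open +-*-Solver
  identity : ∀ e h x → x * (e - h * e) ≡ (1ℚ - h) * x * e
  identity = solve 3 (λ e h x → x :* (e :- h :* e) := (con 1ℚ :- h) :* x :* e) refl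

-- Passing from t to t + h and raising the degree by one gains at least a factor 1 + h; this is why
-- the degree equals the exponent.
[1+h]^≤expSum : ∀ {h} → 0ℚ ≤ h → ∀ m → (1ℚ + h) ^ m ≤ expSum m (ι m * h)
[1+h]^≤expSum {h} 0≤h zero    = ℚ.≤-refl
[1+h]^≤expSum {h} 0≤h (suc m) = ℚ.≤-trans
  (ℚ.*-monoˡ-≤-nonNeg (1ℚ + h) ⦃ ℚ.nonNegative (0≤+ (ℚ.nonNegative⁻¹ 1ℚ) 0≤h) ⦄ ([1+h]^≤expSum 0≤h m))
  (subst₂ _≤_ (identity (expSum m t) h) (cong (expSum (suc m)) (sym (ι-suc-* m h)))
    (ℚ.≤-trans (ℚ.+-monoˡ-≤ (h * expSum m t) (expSum-suc 0≤t m)) (expSum-increment-lower 0≤t 0≤h m)))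
  where
  t = ι m * h
  0≤t : 0ℚ ≤ t
  0≤t = 0≤* (0≤ι m) 0≤h
  open +-*-Solver
  identity : ∀ e h → e + h * e ≡ (1ℚ + h) * e
  identity = solve 2 (λ e h → e :+ h :* e := (con 1ℚ :+ h) :* e) refl

bernoulli : ∀ {x} → 0ℚ ≤ x → x ≤ 1ℚ → ∀ m → 1ℚ - ι m * x ≤ (1ℚ - x) ^ m
bernoulli {x} 0≤x x≤1 zero    = ℚ.≤-reflexive (trans (cong (λ i → 1ℚ - i * x) ι-0) (identity x))
  where
  open +-*-Solver
  identity : ∀ x → 1ℚ - 0ℚ * x ≡ 1ℚ
  identity = solve 1 (λ x → con 1ℚ :- con 0ℚ :* x := con 1ℚ) refl
bernoulli {x} 0≤x x≤1 (suc m) = ≤-by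
  (0≤+ (0≤* (x≤y⇒0≤y-x x≤1) (x≤y⇒0≤y-x (bernoulli 0≤x x≤1 m))) (0≤* (0≤ι m) (0≤* 0≤x 0≤x)))
  (trans (cong (λ z → 1ℚ - z + ((1ℚ - x) * ((1ℚ - x) ^ m - (1ℚ - ι m * x)) + ι m * (x * x))) (ι-suc-* m x))
         (identity x (ι m) ((1ℚ - x) ^ m)))
  where
  open +-*-Solver
  identity : ∀ x i y → 1ℚ - (i * x + x) + ((1ℚ - x) * (y - (1ℚ - i * x)) + i * (x * x)) ≡ (1ℚ - x) * y
  identity = solve 3 (λ x i y →
    con 1ℚ :- (i :* x :+ x) :+ ((con 1ℚ :- x) :* (y :- (con 1ℚ :- i :* x)) :+ i :* (x :* x)) := (con 1ℚ :- x) :* y) refl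

module _ {h n} (0≤h : 0ℚ ≤ h) (h≤1 : h ≤ 1ℚ) (nh≡1 : ι n * h ≡ 1ℚ) where

  [1-h]^n*eSum≤1 : ∀ k → (1ℚ - h) ^ n * eSum k ≤ 1ℚ
  [1-h]^n*eSum≤1 k = subst (λ x → (1ℚ - h) ^ n * x ≤ 1ℚ) (trans (cong (expSum k) nh≡1) (expSum-1 k))
    (expSum-*-[1-h]^ 0≤h h≤1 k n)

  -- Pairing each 1 - h with a factor 1 + h gives (1 - h²)^n, at least 1 - nh² = 1 - h by
  -- Bernoulli's inequality, while (1 + h)^n is at most `eSum n`.
  1-h≤[1-h]^n*eSum : ∀ {k} → n ℕ.≤ k → 1ℚ - h ≤ (1ℚ - h) ^ n * eSum k
  1-h≤[1-h]^n*eSum {k} n≤k = begin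
    1ℚ - h                           ≡⟨ cong (_-_ 1ℚ) (trans (sym (ℚ.*-identityˡ h)) (trans (cong (_* h) (sym nh≡1)) (ℚ.*-assoc (ι n) h h))) ⟩
    1ℚ - ι n * (h * h)               ≤⟨ bernoulli (0≤* 0≤h 0≤h) hh≤1 n ⟩
    (1ℚ - h * h) ^ n                 ≡⟨ cong (_^ n) (identity h) ⟩
    ((1ℚ - h) * (1ℚ + h)) ^ n        ≡⟨ *-^ (1ℚ - h) (1ℚ + h) n ⟩
    (1ℚ - h) ^ n * (1ℚ + h) ^ n      ≤⟨ mono ([1+h]^≤expSum 0≤h n) ⟩
    (1ℚ - h) ^ n * expSum n (ι n * h) ≡⟨ cong ((1ℚ - h) ^ n *_) (trans (cong (expSum n) nh≡1) (expSum-1 n)) ⟩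
    (1ℚ - h) ^ n * eSum n            ≤⟨ mono (subst (λ j → eSum n ≤ eSum j) (ℕ.m∸n+n≡m n≤k) (eSum-lower n (k ℕ.∸ n))) ⟩
    (1ℚ - h) ^ n * eSum k            ∎
    where
    open ℚ.≤-Reasoning
    mono : ∀ {x y} → x ≤ y → (1ℚ - h) ^ n * x ≤ (1ℚ - h) ^ n * y
    mono = ℚ.*-monoˡ-≤-nonNeg ((1ℚ - h) ^ n) ⦃ ℚ.nonNegative (0≤^ (x≤y⇒0≤y-x h≤1) n) ⦄
    hh≤1 : h * h ≤ 1ℚ
    hh≤1 = subst (h * h ≤_) (ℚ.*-identityˡ 1ℚ) (*-mono 0≤h (ℚ.nonNegative⁻¹ 1ℚ) h≤1 h≤1)
    open +-*-Solver
    identity : ∀ h → 1ℚ - h * h ≡ (1ℚ - h) * (1ℚ + h)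
    identity = solve 1 (λ h → con 1ℚ :- h :* h := (con 1ℚ :- h) :* (con 1ℚ :+ h)) refl

-- Sums of powers over the board

-- Unlike ι, lit computes, as the ring solver requires of coefficients.
lit : ℕ → ℚ
lit n = + n / 1

∑-const : ∀ n c → ∑[ _ < n ] c ≡ ι n * c
∑-const zero    c = sym (trans (cong (_* c) ι-0) (ℚ.*-zeroˡ c))
∑-const (suc n) c = trans (cong (_+_ (c)) (∑-const n c)) (trans (ℚ.+-comm c _) (sym (ι-suc-* n c)))

depth-inject₁ : ∀ {n} (x : Fin n) → depth (suc (inject₁ x)) ≡ suc (depth x)
depth-inject₁ {n} x rewrite Fin.toℕ-inject₁ x = cong (suc (toℕ x) ⊓_) (ℕ.+-∸-assoc 1 (Fin.toℕ<n x))

depth-last : ∀ n → depth (suc (Data.Fin.fromℕ n)) ≡ 0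
depth-last n rewrite Fin.toℕ-fromℕ n = trans (cong (suc n ⊓_) (ℕ.n∸n≡0 n)) (ℕ.⊓-zeroʳ (suc n))

-- Peeling in one coordinate: both ends have depth 0, and the spaces between them form a row of
-- length n with all depths raised by one.
∑-depth : ∀ n (g : ℕ → ℚ) →
  ∑[ x < suc (suc n) ] g (depth x) ≡ g 0 + (∑[ x < n ] g (suc (depth x)) + g 0)
∑-depth n g = cong (_+_ (g 0)) (trans (sum-init-last {n} (λ x → g (depth (suc x))))
  (cong₂ _+_ (sum-cong-≗ {n} λ x → cong g (depth-inject₁ x)) (cong g (depth-last n))))

-- With Q = (1 - p)², `K₃` at the three depths is the factor of (1 - p)^A(x) that varies with x.
-- `K₂` is what remains of it on a face of the board, where one depth is 0.
K₂ : ℚ → ℕ → ℕ → ℚ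
K₂ Q u v = Q ^ (u ⊓ v)

K₃ : ℚ → ℕ → ℕ → ℕ → ℚ
K₃ Q u v w = Q ^ (u ⊓ v ℕ.+ u ⊓ w ℕ.+ v ⊓ w)

S₂ : ℚ → ℕ → ℚ
S₂ Q n = ∑[ x < n ] ∑[ y < n ] K₂ Q (depth x) (depth y)

S₃ : ℚ → ℕ → ℚ
S₃ Q n = ∑[ x < n ] ∑[ y < n ] ∑[ z < n ] K₃ Q (depth x) (depth y) (depth z)

module _ (Q : ℚ) (n : ℕ) where

  ∑-K₂-zero : ∑[ y < suc (suc n) ] K₂ Q 0 (depth y) ≡ ι n + lit 2
  ∑-K₂-zero = trans (∑-const (suc (suc n)) 1ℚ) (trans (ℚ.*-identityʳ _)
    (trans (ι-+ 2 n) (trans (ℚ.+-comm (ι 2) (ι n)) (cong (_+_ (ι n)) (ι≡/1 2)))))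

  ∑-K₂-suc : ∀ u → ∑[ y < suc (suc n) ] K₂ Q (suc u) (depth y) ≡ lit 2 + Q * ∑[ y < n ] K₂ Q u (depth y)
  ∑-K₂-suc u = trans (∑-depth n (K₂ Q (suc u)))
    (trans (cong (λ s → 1ℚ + (s + 1ℚ)) (sym (*-distribˡ-sum {n} Q (λ y → K₂ Q u (depth y)))))
           (identity (Q * ∑[ y < n ] K₂ Q u (depth y))))
    where
    open +-*-Solver
    identity : ∀ s → 1ℚ + (s + 1ℚ) ≡ lit 2 + s
    identity = solve 1 (λ s → con 1ℚ :+ (s :+ con 1ℚ) := con (lit 2) :+ s) refl

  -- The 4n + 4 boundary spaces of the square contribute 1 each, and one more unit of depth in both
  -- coordinates multiplies an interior term by Q.
  S₂-recursion : S₂ Q (suc (suc n)) ≡ Q * S₂ Q n + (lit 4 * ι n + lit 4)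
  S₂-recursion = begin
    S₂ Q (suc (suc n))
      ≡⟨ ∑-depth n (λ u → ∑[ y < suc (suc n) ] K₂ Q u (depth y)) ⟩
    e₀ + (∑[ x < n ] ∑[ y < suc (suc n) ] K₂ Q (suc (depth x)) (depth y) + e₀)
      ≡⟨ cong₂ (λ a b → a + (b + a)) ∑-K₂-zero (sum-cong-≗ {n} λ x → ∑-K₂-suc (depth x)) ⟩
    ι n + lit 2 + (∑[ x < n ] (lit 2 + Q * ∑[ y < n ] K₂ Q (depth x) (depth y)) + (ι n + lit 2))
      ≡⟨ cong (λ a → ι n + lit 2 + (a + (ι n + lit 2)))
           (trans (∑-distrib-+ {n} (λ _ → lit 2) (λ x → Q * ∑[ y < n ] K₂ Q (depth x) (depth y)))
             (cong₂ _+_ (∑-const n (lit 2)) (sym (*-distribˡ-sum {n} Q (λ x → ∑[ y < n ] K₂ Q (depth x) (depth y)))))) ⟩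
    ι n + lit 2 + (ι n * lit 2 + Q * S₂ Q n + (ι n + lit 2))
      ≡⟨ identity (ι n) (Q * S₂ Q n) ⟩
    Q * S₂ Q n + (lit 4 * ι n + lit 4) ∎
    where
    open ≡-Reasoning
    e₀ = ∑[ y < suc (suc n) ] K₂ Q 0 (depth y)
    open +-*-Solver
    identity : ∀ i s → i + lit 2 + (i * lit 2 + s + (i + lit 2)) ≡ s + (lit 4 * i + lit 4)
    identity = solve 2 (λ i s → i :+ con (lit 2) :+ (i :* con (lit 2) :+ s :+ (i :+ con (lit 2)))
                                  := s :+ (con (lit 4) :* i :+ con (lit 4))) refl

  ∑-K₃-suc-zero : ∀ u → ∑[ z < suc (suc n) ] K₃ Q (suc u) 0 (depth z)
                          ≡ lit 2 + Q * ∑[ z < n ] K₂ Q u (depth z)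
  ∑-K₃-suc-zero u = trans
    (sum-cong-≗ {suc (suc n)} λ z → cong (Q ^_) (ℕ.+-identityʳ (suc u ⊓ depth z)))
    (∑-K₂-suc u)

  ∑-K₃-suc-suc : ∀ u v → ∑[ z < suc (suc n) ] K₃ Q (suc u) (suc v) (depth z)
                          ≡ lit 2 * Q * K₂ Q u v + Q * Q * Q * ∑[ z < n ] K₃ Q u v (depth z)
  ∑-K₃-suc-suc u v = begin
    ∑[ z < suc (suc n) ] K₃ Q (suc u) (suc v) (depth z)
      ≡⟨ ∑-depth n (K₃ Q (suc u) (suc v)) ⟩
    K₃ Q (suc u) (suc v) 0 + (∑[ z < n ] K₃ Q (suc u) (suc v) (suc (depth z)) + K₃ Q (suc u) (suc v) 0)
      ≡⟨ cong₂ (λ a b → a + (b + a)) (cong (Q ^_) (trans (ℕ.+-identityʳ (suc (u ⊓ v) ℕ.+ 0)) (ℕ.+-identityʳ (suc (u ⊓ v)))))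
           (trans (sum-cong-≗ {n} λ z → shift (depth z))
                  (sym (*-distribˡ-sum {n} (Q * Q * Q) (λ z → K₃ Q u v (depth z))))) ⟩
    Q * K₂ Q u v + (Q * Q * Q * ∑[ z < n ] K₃ Q u v (depth z) + Q * K₂ Q u v)
      ≡⟨ identity Q (K₂ Q u v) (Q * Q * Q * ∑[ z < n ] K₃ Q u v (depth z)) ⟩
    lit 2 * Q * K₂ Q u v + Q * Q * Q * ∑[ z < n ] K₃ Q u v (depth z) ∎
    where
    open ≡-Reasoning
    open +-*-Solver
    identity : ∀ Q k s → Q * k + (s + Q * k) ≡ lit 2 * Q * k + s
    identity = solve 3 (λ Q k s → Q :* k :+ (s :+ Q :* k) := con (lit 2) :* Q :* k :+ s) refl
    shift : ∀ w → K₃ Q (suc u) (suc v) (suc w) ≡ Q * Q * Q * K₃ Q u v w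
    shift w = trans
      (cong (Q ^_) (cong suc (trans (cong (ℕ._+ suc (v ⊓ w)) (ℕ.+-suc (u ⊓ v) (u ⊓ w)))
                                    (cong suc (ℕ.+-suc _ _)))))
      (reassoc Q (K₃ Q u v w))
      where
      reassoc : ∀ Q k → Q * (Q * (Q * k)) ≡ Q * Q * Q * k
      reassoc = solve 2 (λ Q k → Q :* (Q :* (Q :* k)) := Q :* Q :* Q :* k) refl

  ∑∑-K₃-suc : ∀ u → ∑[ y < suc (suc n) ] ∑[ z < suc (suc n) ] K₃ Q (suc u) (depth y) (depth z)
                     ≡ lit 4 + (lit 4 * Q * ∑[ y < n ] K₂ Q u (depth y)
                                 + Q * Q * Q * ∑[ y < n ] ∑[ z < n ] K₃ Q u (depth y) (depth z))
  ∑∑-K₃-suc u = begin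
    ∑[ y < suc (suc n) ] ∑[ z < suc (suc n) ] K₃ Q (suc u) (depth y) (depth z)
      ≡⟨ ∑-depth n (λ v → ∑[ z < suc (suc n) ] K₃ Q (suc u) v (depth z)) ⟩
    c + (∑[ y < n ] ∑[ z < suc (suc n) ] K₃ Q (suc u) (suc (depth y)) (depth z) + c)
      ≡⟨ cong₂ (λ a b → a + (b + a)) (∑-K₃-suc-zero u)
           (trans (sum-cong-≗ {n} λ y → ∑-K₃-suc-suc u (depth y))
           (trans (∑-distrib-+ {n} (λ y → lit 2 * Q * K₂ Q u (depth y)) (λ y → Q * Q * Q * ∑[ z < n ] K₃ Q u (depth y) (depth z)))
             (cong₂ _+_ (sym (*-distribˡ-sum {n} (lit 2 * Q) (λ y → K₂ Q u (depth y))))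
                        (sym (*-distribˡ-sum {n} (Q * Q * Q) (λ y → ∑[ z < n ] K₃ Q u (depth y) (depth z))))))) ⟩
    lit 2 + Q * a + (lit 2 * Q * a + b + (lit 2 + Q * a))
      ≡⟨ identity Q a b ⟩
    lit 4 + (lit 4 * Q * a + b) ∎
    where
    open ≡-Reasoning
    c = ∑[ z < suc (suc n) ] K₃ Q (suc u) 0 (depth z)
    a = ∑[ y < n ] K₂ Q u (depth y)
    b = Q * Q * Q * ∑[ y < n ] ∑[ z < n ] K₃ Q u (depth y) (depth z)
    open +-*-Solver
    identity : ∀ Q a b → lit 2 + Q * a + (lit 2 * Q * a + b + (lit 2 + Q * a)) ≡ lit 4 + (lit 4 * Q * a + b)
    identity = solve 3 (λ Q a b → con (lit 2) :+ Q :* a :+ (con (lit 2) :* Q :* a :+ b :+ (con (lit 2) :+ Q :* a))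
                                    := con (lit 4) :+ (con (lit 4) :* Q :* a :+ b)) refl

  -- The cube splits into its interior, with Q³ from raising all three minima by one, six open faces
  -- contributing Q · S₂ each, and twelve open edges of length n and eight corners, where every term
  -- is 1.
  S₃-recursion : S₃ Q (suc (suc n)) ≡ Q * Q * Q * S₃ Q n + (lit 6 * Q * S₂ Q n + (lit 12 * ι n + lit 8))
  S₃-recursion = begin
    S₃ Q (suc (suc n))
      ≡⟨ ∑-depth n (λ u → ∑[ y < suc (suc n) ] ∑[ z < suc (suc n) ] K₃ Q u (depth y) (depth z)) ⟩
    -- On the two faces orthogonal to the first axis, `K₃ Q 0` reduces to `K₂ Q`, so each face is a
    -- full `S₂` of side n + 2.
    S₂ Q (suc (suc n)) + (∑[ x < n ] ∑[ y < suc (suc n) ] ∑[ z < suc (suc n) ] K₃ Q (suc (depth x)) (depth y) (depth z)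
                           + S₂ Q (suc (suc n)))
      ≡⟨ cong₂ (λ a b → a + (b + a)) S₂-recursion
           (trans (sum-cong-≗ {n} λ x → ∑∑-K₃-suc (depth x))
           (trans (∑-distrib-+ {n} (λ _ → lit 4) (λ x → lit 4 * Q * a x + Q * Q * Q * b x))
             (cong₂ _+_ (∑-const n (lit 4))
               (trans (∑-distrib-+ {n} (λ x → lit 4 * Q * a x) (λ x → Q * Q * Q * b x))
                 (cong₂ _+_ (sym (*-distribˡ-sum {n} (lit 4 * Q) a)) (sym (*-distribˡ-sum {n} (Q * Q * Q) b))))))) ⟩
    Q * S₂ Q n + (lit 4 * ι n + lit 4)
      + (ι n * lit 4 + (lit 4 * Q * S₂ Q n + Q * Q * Q * S₃ Q n) + (Q * S₂ Q n + (lit 4 * ι n + lit 4)))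
      ≡⟨ identity Q (ι n) (S₂ Q n) (Q * Q * Q * S₃ Q n) ⟩
    Q * Q * Q * S₃ Q n + (lit 6 * Q * S₂ Q n + (lit 12 * ι n + lit 8)) ∎
    where
    open ≡-Reasoning
    a b : Fin n → ℚ
    a x = ∑[ y < n ] K₂ Q (depth x) (depth y)
    b x = ∑[ y < n ] ∑[ z < n ] K₃ Q (depth x) (depth y) (depth z)
    open +-*-Solver
    identity : ∀ Q i s r → Q * s + (lit 4 * i + lit 4) + (i * lit 4 + (lit 4 * Q * s + r) + (Q * s + (lit 4 * i + lit 4)))
                             ≡ r + (lit 6 * Q * s + (lit 12 * i + lit 8))
    identity = solve 4 (λ Q i s r →
      Q :* s :+ (con (lit 4) :* i :+ con (lit 4)) :+ (i :* con (lit 4) :+ (con (lit 4) :* Q :* s :+ r) :+ (Q :* s :+ (con (lit 4) :* i :+ con (lit 4))))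
        := r :+ (con (lit 6) :* Q :* s :+ (con (lit 12) :* i :+ con (lit 8)))) refl

-- Solving the recursions approximately

∣∣≤-lit : ∀ n → ∣ lit n ∣ ≤ lit n
∣∣≤-lit n = ∣∣≤-self (subst (0ℚ ≤_) (ι≡/1 n) (0≤ι n))

ι-suc²-* : ∀ m h → ι (suc (suc m)) * h ≡ ι m * h + lit 2 * h
ι-suc²-* m h = trans (cong (_* h) (trans (ι-+ 2 m) (cong (_+ ι m) (ι≡/1 2)))) (identity (ι m) h)
  where
  open +-*-Solver
  identity : ∀ i h → (lit 2 + i) * h ≡ i * h + lit 2 * h
  identity = solve 2 (λ i h → (con (lit 2) :+ i) :* h := i :* h :+ con (lit 2) :* h) refl

-- With t = pm and w = (1 - p)^m ≈ e^{-t}, the functions f₂ and f₃ of t solve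
-- f₂′ = 2t - f₂ and f₃′ = 9f₂ - 3f₃, the limits of the recursions of p²S₂
-- and 3p³S₃ as p → 0.
module _ {p : ℚ} (0≤p : 0ℚ ≤ p) (p≤1 : p ≤ 1ℚ) where

  private
    q Q : ℚ
    q = 1ℚ - p
    Q = q * q

    t : ℕ → ℚ
    t m = ι m * p

  f₂ f₃ : ℕ → ℚ
  f₂ m = lit 2 * t m - lit 2 + lit 2 * q ^ m
  f₃ m = lit 6 * t m - lit 8 + lit 9 * q ^ m - q ^ m * q ^ m * q ^ m

  private
    ∣p∣≤1 : ∣ p ∣ ≤ 1ℚ
    ∣p∣≤1 = ∣∣≤-nonNeg 0≤p p≤1

    0≤q : 0ℚ ≤ q
    0≤q = x≤y⇒0≤y-x p≤1

    ∣q∣≤1 : ∣ q ∣ ≤ 1ℚ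
    ∣q∣≤1 = ∣∣≤-nonNeg 0≤q (p≤q+r⇒p-r≤q {r = p} (≤-+ʳ 1ℚ 0≤p))

    0≤t : ∀ m → 0ℚ ≤ t m
    0≤t m = 0≤* (0≤ι m) 0≤p

    t-suc² : ∀ m → t (suc (suc m)) ≡ t m + lit 2 * p
    t-suc² m = ι-suc²-* m p

    t-pred² : ∀ m → t (suc (suc m)) ≤ 1ℚ → t m ≤ 1ℚ
    t-pred² m = ℚ.≤-trans (subst (t m ≤_) (sym (t-suc² m)) (≤-+ʳ (t m) (0≤* (ℚ.nonNegative⁻¹ (lit 2)) 0≤p)))

  -- Inserting f₂ into the recursion leaves the defect p²(2 + 2t), at most 4p² because t ≤ 1. The
  -- bound 2pt grows by exactly 4p² when t grows by 2p. Peeling lowers m by two, hence two base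
  -- cases.
  S₂-approx : ∀ m → t m ≤ 1ℚ → ∣ p * p * S₂ Q m - f₂ m ∣ ≤ lit 2 * (p * t m)
  S₂-approx zero _ = ℚ.≤-reflexive (trans (cong ∣_∣
    (trans (cong (λ i → p * p * 0ℚ - (lit 2 * (i * p) - lit 2 + lit 2 * 1ℚ)) ι-0) (identity p)))
    (sym (trans (cong (λ i → lit 2 * (p * (i * p))) ι-0) (identity′ p))))
    where
    open +-*-Solver
    identity : ∀ p → p * p * 0ℚ - (lit 2 * (0ℚ * p) - lit 2 + lit 2 * 1ℚ) ≡ 0ℚ
    identity = solve 1 (λ p → p :* p :* con 0ℚ :- (con (lit 2) :* (con 0ℚ :* p) :- con (lit 2) :+ con (lit 2) :* con 1ℚ) := con 0ℚ) refl
    identity′ : ∀ p → lit 2 * (p * (0ℚ * p)) ≡ 0ℚ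
    identity′ = solve 1 (λ p → con (lit 2) :* (p :* (con 0ℚ :* p)) := con 0ℚ) refl
  S₂-approx (suc zero) _ = subst₂ _≤_
    (cong ∣_∣ (trans (sym (identity p)) (cong (λ i → p * p * S₂ Q 1 - (lit 2 * (i * p) - lit 2 + lit 2 * (q * 1ℚ))) (sym ι-1))))
    (cong (λ i → lit 2 * (p * (i * p))) (sym ι-1))
    (∣∣≤-nonNeg (0≤* 0≤p 0≤p) (≤-by (0≤* 0≤p 0≤p) (identity′ p)))
    where
    open +-*-Solver
    identity : ∀ p → p * p * (1ℚ + 0ℚ + 0ℚ) - (lit 2 * (1ℚ * p) - lit 2 + lit 2 * ((1ℚ - p) * 1ℚ)) ≡ p * p
    identity = solve 1 (λ p → p :* p :* (con 1ℚ :+ con 0ℚ :+ con 0ℚ) :-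
      (con (lit 2) :* (con 1ℚ :* p) :- con (lit 2) :+ con (lit 2) :* ((con 1ℚ :- p) :* con 1ℚ)) := p :* p) refl
    identity′ : ∀ p → p * p + p * p ≡ lit 2 * (p * (1ℚ * p))
    identity′ = solve 1 (λ p → p :* p :+ p :* p := con (lit 2) :* (p :* (con 1ℚ :* p))) refl
  S₂-approx (suc (suc m)) t≤1 = subst₂ _≤_
    (cong ∣_∣ (trans (step p (ι m) (S₂ Q m) (q ^ m))
      (cong₂ (λ s u → p * p * s - (lit 2 * u - lit 2 + lit 2 * q ^ suc (suc m))) (sym (S₂-recursion Q m)) (sym (t-suc² m)))))
    (trans (bound p (t m)) (cong (λ u → lit 2 * (p * u)) (sym (t-suc² m))))
    (∣∣≤-+
      (∣∣≤-* (∣∣≤-* ∣q∣≤1 ∣q∣≤1) (S₂-approx m t′≤1))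
      (∣∣≤-* (∣∣≤-* (∣∣≤-self 0≤p) (∣∣≤-self 0≤p))
             (∣∣≤-+ (∣∣≤-lit 2) (∣∣≤-* (∣∣≤-lit 2) (∣∣≤-nonNeg (0≤t m) t′≤1)))))
    where
    t′≤1 = t-pred² m t≤1
    open +-*-Solver
    step : ∀ p i s w → let q = 1ℚ - p in
      q * q * (p * p * s - (lit 2 * (i * p) - lit 2 + lit 2 * w)) + p * p * (lit 2 + lit 2 * (i * p))
        ≡ p * p * (q * q * s + (lit 4 * i + lit 4)) - (lit 2 * (i * p + lit 2 * p) - lit 2 + lit 2 * (q * (q * w)))
    step = solve 4 (λ p i s w → let q = con 1ℚ :- p in
      q :* q :* (p :* p :* s :- (con (lit 2) :* (i :* p) :- con (lit 2) :+ con (lit 2) :* w)) :+ p :* p :* (con (lit 2) :+ con (lit 2) :* (i :* p))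
        := p :* p :* (q :* q :* s :+ (con (lit 4) :* i :+ con (lit 4))) :- (con (lit 2) :* (i :* p :+ con (lit 2) :* p) :- con (lit 2) :+ con (lit 2) :* (q :* (q :* w)))) refl
    bound : ∀ p t → 1ℚ * 1ℚ * (lit 2 * (p * t)) + p * p * (lit 2 + lit 2 * 1ℚ) ≡ lit 2 * (p * (t + lit 2 * p))
    bound = solve 2 (λ p t → con 1ℚ :* con 1ℚ :* (con (lit 2) :* (p :* t)) :+ p :* p :* (con (lit 2) :+ con (lit 2) :* con 1ℚ)
                               := con (lit 2) :* (p :* (t :+ con (lit 2) :* p))) refl

  -- The term 6Q · S₂ of the recursion becomes 18pQ times p²S₂, so the O(p) error of `S₂-approx`
  -- enters with a further factor p and contributes O(p²) per step.
  S₃-approx : ∀ m → t m ≤ 1ℚ → ∣ lit 3 * (p * p * p) * S₃ Q m - f₃ m ∣ ≤ lit 400 * (p * t m)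
  S₃-approx zero _ = ℚ.≤-reflexive (trans (cong ∣_∣
    (trans (cong (λ i → lit 3 * (p * p * p) * 0ℚ - (lit 6 * (i * p) - lit 8 + lit 9 * 1ℚ - 1ℚ * 1ℚ * 1ℚ)) ι-0) (identity p)))
    (sym (trans (cong (λ i → lit 400 * (p * (i * p))) ι-0) (identity′ p))))
    where
    open +-*-Solver
    identity : ∀ p → lit 3 * (p * p * p) * 0ℚ - (lit 6 * (0ℚ * p) - lit 8 + lit 9 * 1ℚ - 1ℚ * 1ℚ * 1ℚ) ≡ 0ℚ
    identity = solve 1 (λ p → con (lit 3) :* (p :* p :* p) :* con 0ℚ :-
      (con (lit 6) :* (con 0ℚ :* p) :- con (lit 8) :+ con (lit 9) :* con 1ℚ :- con 1ℚ :* con 1ℚ :* con 1ℚ) := con 0ℚ) refl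
    identity′ : ∀ p → lit 400 * (p * (0ℚ * p)) ≡ 0ℚ
    identity′ = solve 1 (λ p → con (lit 400) :* (p :* (con 0ℚ :* p)) := con 0ℚ) refl
  S₃-approx (suc zero) _ = subst₂ _≤_
    (cong ∣_∣ (trans (sym (identity p)) (cong (λ i → lit 3 * (p * p * p) * S₃ Q 1 -
      (lit 6 * (i * p) - lit 8 + lit 9 * (q * 1ℚ) - q * 1ℚ * (q * 1ℚ) * (q * 1ℚ))) (sym ι-1))))
    (cong (λ i → lit 400 * (p * (i * p))) (sym ι-1))
    (ℚ.≤-trans
      (∣∣≤-* (∣∣≤-* (∣∣≤-self 0≤p) (∣∣≤-self 0≤p)) (∣∣≤-+ (∣∣≤-lit 3) (∣∣≤-* (∣∣≤-lit 2) ∣p∣≤1)))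
      -- 395 = 400 - 5, where 5 bounds 3 + 2p.
      (≤-by (0≤* (ℚ.nonNegative⁻¹ (lit 395)) (0≤* 0≤p 0≤p)) (identity′ p)))
    where
    open +-*-Solver
    identity : ∀ p → let q = 1ℚ - p in
      lit 3 * (p * p * p) * (1ℚ + 0ℚ + 0ℚ + 0ℚ) - (lit 6 * (1ℚ * p) - lit 8 + lit 9 * (q * 1ℚ) - q * 1ℚ * (q * 1ℚ) * (q * 1ℚ))
        ≡ p * p * (lit 3 + lit 2 * p)
    identity = solve 1 (λ p → let q = con 1ℚ :- p in
      con (lit 3) :* (p :* p :* p) :* (con 1ℚ :+ con 0ℚ :+ con 0ℚ :+ con 0ℚ) :-
        (con (lit 6) :* (con 1ℚ :* p) :- con (lit 8) :+ con (lit 9) :* (q :* con 1ℚ) :- q :* con 1ℚ :* (q :* con 1ℚ) :* (q :* con 1ℚ))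
        := p :* p :* (con (lit 3) :+ con (lit 2) :* p)) refl
    identity′ : ∀ p → p * p * (lit 3 + lit 2 * 1ℚ) + lit 395 * (p * p) ≡ lit 400 * (p * (1ℚ * p))
    identity′ = solve 1 (λ p → p :* p :* (con (lit 3) :+ con (lit 2) :* con 1ℚ) :+ con (lit 395) :* (p :* p)
                                 := con (lit 400) :* (p :* (con 1ℚ :* p))) refl
  S₃-approx (suc (suc m)) t≤1 = ℚ.≤-trans
    (subst (λ x → ∣ x ∣ ≤ 1ℚ * (lit 400 * (p * t m)) + (lit 18 * p * 1ℚ * (lit 2 * (p * 1ℚ)) + p * p * lit 741))
      (trans (step p (ι m) (S₂ Q m) (S₃ Q m) (q ^ m))
        (cong₂ (λ s u → lit 3 * (p * p * p) * s - (lit 6 * u - lit 8 + lit 9 * q ^ suc (suc m)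
                          - q ^ suc (suc m) * q ^ suc (suc m) * q ^ suc (suc m)))
          (sym (S₃-recursion Q m)) (sym (t-suc² m))))
      (∣∣≤-+ (∣∣≤-* (∣∣≤-* (∣∣≤-* ∣Q∣≤1 ∣Q∣≤1) ∣Q∣≤1) (S₃-approx m t′≤1))
      (∣∣≤-+ (∣∣≤-* (∣∣≤-* (∣∣≤-* (∣∣≤-lit 18) (∣∣≤-self 0≤p)) ∣Q∣≤1)
                    (ℚ.≤-trans (S₂-approx m t′≤1)
                      (ℚ.*-monoˡ-≤-nonNeg (lit 2) (ℚ.*-monoˡ-≤-nonNeg p ⦃ ℚ.nonNegative 0≤p ⦄ t′≤1))))
             (∣∣≤-* (∣∣≤-* (∣∣≤-self 0≤p) (∣∣≤-self 0≤p)) ∣defect∣≤))))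
    -- The slack is 23 = 800 - 36 - 741.
    (≤-by (0≤* (ℚ.nonNegative⁻¹ (lit 23)) (0≤* 0≤p 0≤p))
      (trans (bound p (t m)) (cong (λ u → lit 400 * (p * u)) (sym (t-suc² m)))))
    where
    t′≤1 = t-pred² m t≤1
    ∣t∣≤1 : ∣ t m ∣ ≤ 1ℚ
    ∣t∣≤1 = ∣∣≤-nonNeg (0≤t m) t′≤1
    ∣Q∣≤1 : ∣ Q ∣ ≤ 1ℚ
    ∣Q∣≤1 = ∣∣≤-* ∣q∣≤1 ∣q∣≤1
    -- p²·defect is the error that f₃ makes in the recursion of 3p³S₃; 741 is the
    -- sum of the absolute values of the coefficients.  With the error 36p² coming
    -- from S₂-approx, it stays below the allowed increment 400·2p².
    defect : ℚ → ℚ → ℚ → ℚ → ℚ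
    defect p q t w =
      lit 6 * t * (lit 9 + p * (- lit 14 + p * (lit 15 + p * (- lit 6 + p))))
        + (- lit 48 + p * (lit 148 + p * (- lit 120 + p * (lit 48 + p * (- lit 8)))))
        + lit 9 * (q * q * w) * (lit 6 + p * (- lit 4 + p))
    ∣defect∣≤ : ∣ defect p q (t m) (q ^ m) ∣ ≤ lit 741
    ∣defect∣≤ =
      ∣∣≤-+ (∣∣≤-+
        (∣∣≤-* (∣∣≤-* (∣∣≤-lit 6) ∣t∣≤1)
          (∣∣≤-+ (∣∣≤-lit 9) (∣∣≤-* ∣p∣≤1 (∣∣≤-+ {x = - lit 14} {B = lit 22} (ℚ.≤-refl {lit 14}) (∣∣≤-* ∣p∣≤1
            (∣∣≤-+ (∣∣≤-lit 15) (∣∣≤-* ∣p∣≤1 (∣∣≤-+ {x = - lit 6} (ℚ.≤-refl {lit 6}) ∣p∣≤1))))))))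
        (∣∣≤-+ {x = - lit 48} (ℚ.≤-refl {lit 48}) (∣∣≤-* ∣p∣≤1 (∣∣≤-+ (∣∣≤-lit 148) (∣∣≤-* ∣p∣≤1
          (∣∣≤-+ {x = - lit 120} (ℚ.≤-refl {lit 120}) (∣∣≤-* ∣p∣≤1 (∣∣≤-+ (∣∣≤-lit 48)
            (∣∣≤-* {y = - lit 8} ∣p∣≤1 (ℚ.≤-refl {lit 8}))))))))))
      (∣∣≤-* (∣∣≤-* (∣∣≤-lit 9) (∣∣≤-* ∣Q∣≤1 (∣∣≤-^ ∣q∣≤1 m)))
        (∣∣≤-+ (∣∣≤-lit 6) (∣∣≤-* ∣p∣≤1 (∣∣≤-+ {x = - lit 4} (ℚ.≤-refl {lit 4}) ∣p∣≤1))))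
    open +-*-Solver
    step : ∀ p i s r w → let q = 1ℚ - p; Q = q * q in
      Q * Q * Q * (lit 3 * (p * p * p) * r - (lit 6 * (i * p) - lit 8 + lit 9 * w - w * w * w))
        + (lit 18 * p * Q * (p * p * s - (lit 2 * (i * p) - lit 2 + lit 2 * w)) + p * p * defect p q (i * p) w)
        ≡ lit 3 * (p * p * p) * (Q * Q * Q * r + (lit 6 * Q * s + (lit 12 * i + lit 8)))
          - (lit 6 * (i * p + lit 2 * p) - lit 8 + lit 9 * (q * (q * w)) - q * (q * w) * (q * (q * w)) * (q * (q * w)))
    step = solve 5 (λ p i s r w → let q = con 1ℚ :- p; Q = q :* q; t = i :* p in
      Q :* Q :* Q :* (con (lit 3) :* (p :* p :* p) :* r :- (con (lit 6) :* t :- con (lit 8) :+ con (lit 9) :* w :- w :* w :* w))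
        :+ (con (lit 18) :* p :* Q :* (p :* p :* s :- (con (lit 2) :* t :- con (lit 2) :+ con (lit 2) :* w))
        :+ p :* p :* (con (lit 6) :* t :* (con (lit 9) :+ p :* (con (- lit 14) :+ p :* (con (lit 15) :+ p :* (con (- lit 6) :+ p))))
        :+ (con (- lit 48) :+ p :* (con (lit 148) :+ p :* (con (- lit 120) :+ p :* (con (lit 48) :+ p :* con (- lit 8)))))
        :+ con (lit 9) :* (q :* q :* w) :* (con (lit 6) :+ p :* (con (- lit 4) :+ p))))
        := con (lit 3) :* (p :* p :* p) :* (Q :* Q :* Q :* r :+ (con (lit 6) :* Q :* s :+ (con (lit 12) :* i :+ con (lit 8))))
          :- (con (lit 6) :* (t :+ con (lit 2) :* p) :- con (lit 8) :+ con (lit 9) :* (q :* (q :* w)) :- q :* (q :* w) :* (q :* (q :* w)) :* (q :* (q :* w)))) refl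
    bound : ∀ p t → 1ℚ * (lit 400 * (p * t)) + (lit 18 * p * 1ℚ * (lit 2 * (p * 1ℚ)) + p * p * lit 741) + lit 23 * (p * p)
                      ≡ lit 400 * (p * (t + lit 2 * p))
    bound = solve 2 (λ p t → con 1ℚ :* (con (lit 400) :* (p :* t)) :+ (con (lit 18) :* p :* con 1ℚ :* (con (lit 2) :* (p :* con 1ℚ)) :+ p :* p :* con (lit 741)) :+ con (lit 23) :* (p :* p)
                      := con (lit 400) :* (p :* (t :+ con (lit 2) :* p))) refl

-- The probability that given spaces stay empty

[1+m]*mCk≡[1+k]*[1+m]C[1+k] : ∀ m k → suc m ℕ.* (m C k) ≡ suc k ℕ.* (suc m C suc k)
[1+m]*mCk≡[1+k]*[1+m]C[1+k] m zero =
  trans (ℕ.*-identityʳ (suc m)) (trans (sym (nC1≡n (suc m))) (sym (ℕ.*-identityˡ (suc m C 1))))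
[1+m]*mCk≡[1+k]*[1+m]C[1+k] zero (suc k) = trans
  (cong (1 ℕ.*_) (k>n⇒nCk≡0 {0} {suc k} (s≤s z≤n)))
  (sym (trans (cong (suc (suc k) ℕ.*_) (k>n⇒nCk≡0 {1} {suc (suc k)} (s≤s (s≤s z≤n)))) (ℕ.*-zeroʳ (suc (suc k)))))
[1+m]*mCk≡[1+k]*[1+m]C[1+k] (suc m) (suc k) = begin
  suc (suc m) ℕ.* c                                    ≡⟨ cong (c ℕ.+_) (cong (suc m ℕ.*_) (sym (nCk+nC[k+1]≡[n+1]C[k+1] m k))) ⟩
  c ℕ.+ suc m ℕ.* (m C k ℕ.+ m C suc k)                ≡⟨ cong (c ℕ.+_) (ℕ.*-distribˡ-+ (suc m) (m C k) (m C suc k)) ⟩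
  c ℕ.+ (suc m ℕ.* (m C k) ℕ.+ suc m ℕ.* (m C suc k))  ≡⟨ cong₂ (λ x y → c ℕ.+ (x ℕ.+ y)) ([1+m]*mCk≡[1+k]*[1+m]C[1+k] m k)
                                                                                  ([1+m]*mCk≡[1+k]*[1+m]C[1+k] m (suc k)) ⟩
  c ℕ.+ (suc k ℕ.* c ℕ.+ suc (suc k) ℕ.* (suc m C suc (suc k))) ≡⟨ ℕ.+-assoc c (suc k ℕ.* c) _ ⟨
  suc (suc k) ℕ.* c ℕ.+ suc (suc k) ℕ.* (suc m C suc (suc k))   ≡⟨ ℕ.*-distribˡ-+ (suc (suc k)) c _ ⟨
  suc (suc k) ℕ.* (c ℕ.+ suc m C suc (suc k))          ≡⟨ cong (suc (suc k) ℕ.*_) (nCk+nC[k+1]≡[n+1]C[k+1] (suc m) (suc k)) ⟩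
  suc (suc k) ℕ.* (suc (suc m) C suc (suc k))          ∎
  where
  open ≡-Reasoning
  c = suc m C suc k

-- The ratio C(m,k) / C(m+1,k) = 1 - k/(m+1), cleared of division and subtraction. It governs the
-- change of `ρ` when one more space has to stay empty.
[1+m]*mCk+k*[1+m]Ck≡[1+m]*[1+m]Ck : ∀ m k → suc m ℕ.* (m C k) ℕ.+ k ℕ.* (suc m C k) ≡ suc m ℕ.* (suc m C k)
[1+m]*mCk+k*[1+m]Ck≡[1+m]*[1+m]Ck m zero    = ℕ.+-identityʳ _
[1+m]*mCk+k*[1+m]Ck≡[1+m]*[1+m]Ck m (suc k) = begin
  suc m ℕ.* (m C suc k) ℕ.+ suc k ℕ.* (suc m C suc k)  ≡⟨ cong (suc m ℕ.* (m C suc k) ℕ.+_) ([1+m]*mCk≡[1+k]*[1+m]C[1+k] m k) ⟨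
  suc m ℕ.* (m C suc k) ℕ.+ suc m ℕ.* (m C k)          ≡⟨ ℕ.*-distribˡ-+ (suc m) (m C suc k) (m C k) ⟨
  suc m ℕ.* (m C suc k ℕ.+ m C k)                      ≡⟨ cong (suc m ℕ.*_) (trans (ℕ.+-comm (m C suc k) (m C k)) (nCk+nC[k+1]≡[n+1]C[k+1] m k)) ⟩
  suc m ℕ.* (suc m C suc k)                            ∎
  where open ≡-Reasoning

mCk≤[1+m]Ck : ∀ m k → m C k ℕ.≤ suc m C k
mCk≤[1+m]Ck m zero    = ℕ.≤-refl
mCk≤[1+m]Ck m (suc k) = subst (m C suc k ℕ.≤_) (nCk+nC[k+1]≡[n+1]C[k+1] m k) (ℕ.m≤n+m (m C suc k) (m C k))

[m∸a]Ck≤mCk : ∀ m a k → (m ∸ a) C k ℕ.≤ m C k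
[m∸a]Ck≤mCk m       zero    k = ℕ.≤-refl
[m∸a]Ck≤mCk zero    (suc a) k = ℕ.≤-refl
[m∸a]Ck≤mCk (suc m) (suc a) k = ℕ.≤-trans ([m∸a]Ck≤mCk m a k) (mCk≤[1+m]Ck m k)

-- n³ - n² - 6n = n(n - 3)(n + 2), which is where 3 ≤ n comes from. At least n² spaces remain after
-- removing up to 6n of them.
n²+6n≤n³ : ∀ {n} → 3 ℕ.≤ n → n ℕ.^ 2 ℕ.+ n ℕ.* 6 ℕ.≤ n ℕ.^ 3
n²+6n≤n³ {n} 3≤n = subst (λ m → m ℕ.^ 2 ℕ.+ m ℕ.* 6 ℕ.≤ m ℕ.^ 3) (ℕ.m+[n∸m]≡n 3≤n) (shifted (n ∸ 3))
  where
  open ℕ.+-*-Solver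
  identity : ∀ j → let m = 3 ℕ.+ j in
    m ℕ.* (m ℕ.* 1) ℕ.+ m ℕ.* 6 ℕ.+ (j ℕ.* j ℕ.* j ℕ.+ 8 ℕ.* (j ℕ.* j) ℕ.+ 15 ℕ.* j) ≡ m ℕ.* (m ℕ.* (m ℕ.* 1))
  identity = solve 1 (λ j → let m = con 3 :+ j in
    m :* (m :* con 1) :+ m :* con 6 :+ (j :* j :* j :+ con 8 :* (j :* j) :+ con 15 :* j) := m :* (m :* (m :* con 1))) refl
  shifted : ∀ j → (3 ℕ.+ j) ℕ.^ 2 ℕ.+ (3 ℕ.+ j) ℕ.* 6 ℕ.≤ (3 ℕ.+ j) ℕ.^ 3
  shifted j = subst ((3 ℕ.+ j) ℕ.^ 2 ℕ.+ (3 ℕ.+ j) ℕ.* 6 ℕ.≤_) (identity j) (ℕ.m≤m+n ((3 ℕ.+ j) ℕ.^ 2 ℕ.+ (3 ℕ.+ j) ℕ.* 6) _)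

-- ρ a is the probability that a given set of a spaces is left empty.
module Avoidance {n : ℕ} (3≤n : 3 ℕ.≤ n) {p : ℚ} (0≤p : 0ℚ ≤ p) (p≤1 : p ≤ 1ℚ) (np≡1 : ι n * p ≡ 1ℚ)
                 {τ : ℚ} (0≤τ : 0ℚ ≤ τ) (τ≡ : τ * ι ((n ℕ.^ 3) C (n ℕ.^ 2)) ≡ 1ℚ) where

  ρ : ℕ → ℚ
  ρ a = ι ((n ℕ.^ 3 ∸ a) C (n ℕ.^ 2)) * τ

  private
    q : ℚ
    q = 1ℚ - p

  0≤ρ : ∀ a → 0ℚ ≤ ρ a
  0≤ρ a = 0≤* (0≤ι _) 0≤τ

  ρ≤1 : ∀ a → ρ a ≤ 1ℚ
  ρ≤1 a = subst (ρ a ≤_) (trans (ℚ.*-comm _ τ) τ≡)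
    (ℚ.*-monoʳ-≤-nonNeg τ ⦃ ℚ.nonNegative 0≤τ ⦄ (ι-mono-≤ ([m∸a]Ck≤mCk (n ℕ.^ 3) a (n ℕ.^ 2))))

  -- Writing n³ - a as m + 1 keeps truncated subtraction out of the estimate; `r` is then ρ a and
  -- `ρ-suc` is ρ (a + 1).
  module _ (a m : ℕ) (a≤6n : a ℕ.≤ n ℕ.* 6) (eq : n ℕ.^ 3 ≡ suc m ℕ.+ a) where

    private
      ρ-suc : ℚ
      ρ-suc = ι (m C (n ℕ.^ 2)) * τ

      r : ℚ
      r = ι (suc m C (n ℕ.^ 2)) * τ

    -- The exact ratio of the two probabilities is 1 - n²/(m+1). Since n² = p · n³ = p(m + 1 + a),
    -- it misses 1 - p by pa/(m+1).
    ρ-step-exact : (ρ-suc - q * r) * ι (suc m) ≡ - (p * ι a * r)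
    ρ-step-exact = trans (identity₁ p ρ-suc r (ι (suc m)) (ι (n ℕ.^ 2))) (trans
      (cong (λ x → x - ι (suc m) * r + r * (p * ι (suc m) - ι (n ℕ.^ 2))) recursion)
      (trans (cong (λ k → ι (suc m) * r - ι (suc m) * r + r * (p * ι (suc m) - k)) K≡) (identity₂ p r (ι (suc m)) (ι a))))
      where
      recursion : ι (suc m) * ρ-suc + ι (n ℕ.^ 2) * r ≡ ι (suc m) * r
      recursion = trans (factor (ι (suc m)) _ (ι (n ℕ.^ 2)) _ τ) (trans
        (cong (_* τ) (trans (cong₂ _+_ (sym (ι-* (suc m) _)) (sym (ι-* (n ℕ.^ 2) _)))
          (trans (sym (ι-+ (suc m ℕ.* _) _)) (trans (cong ι ([1+m]*mCk+k*[1+m]Ck≡[1+m]*[1+m]Ck m (n ℕ.^ 2))) (ι-* (suc m) _)))))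
        (ℚ.*-assoc (ι (suc m)) _ τ))
        where
        open +-*-Solver
        factor : ∀ a b c d t → a * (b * t) + c * (d * t) ≡ (a * b + c * d) * t
        factor = solve 5 (λ a b c d t → a :* (b :* t) :+ c :* (d :* t) := (a :* b :+ c :* d) :* t) refl
      K≡ : ι (n ℕ.^ 2) ≡ p * (ι (suc m) + ι a)
      K≡ = trans (sym (ℚ.*-identityˡ _)) (trans (cong (_* ι (n ℕ.^ 2)) (trans (sym np≡1) (ℚ.*-comm (ι n) p)))
        (trans (ℚ.*-assoc p (ι n) _) (cong (p *_) (trans (sym (ι-* n (n ℕ.^ 2))) (trans (cong ι eq) (ι-+ (suc m) a))))))
      open +-*-Solver
      identity₁ : ∀ p s r i k → (s - (1ℚ - p) * r) * i ≡ (i * s + k * r) - i * r + r * (p * i - k)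
      identity₁ = solve 5 (λ p s r i k → (s :- (con 1ℚ :- p) :* r) :* i := (i :* s :+ k :* r) :- i :* r :+ r :* (p :* i :- k)) refl
      identity₂ : ∀ p r i a → i * r - i * r + r * (p * i - p * (i + a)) ≡ - (p * a * r)
      identity₂ = solve 4 (λ p r i a → i :* r :- i :* r :+ r :* (p :* i :- p :* (i :+ a)) := :- (p :* a :* r)) refl

    -- In `ρ-step-exact`, pa is at most 6, r at most 1, and m + 1 at least n² = 1/p². Instead of
    -- dividing by m + 1, the proof multiplies by (m + 1)p² ≥ 1.
    ρ-step : ∣ ρ-suc - q * r ∣ ≤ lit 6 * (p * p)
    ρ-step = begin
      ∣ D ∣                              ≡⟨ ℚ.*-identityʳ ∣ D ∣ ⟨
      ∣ D ∣ * 1ℚ                         ≤⟨ ℚ.*-monoˡ-≤-nonNeg ∣ D ∣ ⦃ ℚ.∣-∣-nonNeg D ⦄ 1≤ ⟩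
      ∣ D ∣ * (ι (suc m) * (p * p))      ≡⟨ ℚ.*-assoc ∣ D ∣ (ι (suc m)) (p * p) ⟨
      ∣ D ∣ * ι (suc m) * (p * p)        ≡⟨ cong (λ x → ∣ D ∣ * x * (p * p)) (ℚ.0≤p⇒∣p∣≡p (0≤ι (suc m))) ⟨
      ∣ D ∣ * ∣ ι (suc m) ∣ * (p * p)    ≡⟨ cong (_* (p * p)) (ℚ.∣p*q∣≡∣p∣*∣q∣ D (ι (suc m))) ⟨
      ∣ D * ι (suc m) ∣ * (p * p)        ≡⟨ cong (λ x → ∣ x ∣ * (p * p)) ρ-step-exact ⟩
      ∣ - (p * ι a * r) ∣ * (p * p)      ≡⟨ cong (_* (p * p)) (ℚ.∣-p∣≡∣p∣ (p * ι a * r)) ⟩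
      ∣ p * ι a * r ∣ * (p * p)          ≤⟨ ℚ.*-monoʳ-≤-nonNeg (p * p) ⦃ ℚ.nonNegative (0≤* 0≤p 0≤p) ⦄
                                              (∣∣≤-* {B = 1ℚ} (∣∣≤-nonNeg (0≤* 0≤p (0≤ι a)) pa≤6) ∣r∣≤1) ⟩
      lit 6 * 1ℚ * (p * p)               ≡⟨ cong (_* (p * p)) (ℚ.*-identityʳ (lit 6)) ⟩
      lit 6 * (p * p)                    ∎
      where
      open ℚ.≤-Reasoning
      D : ℚ
      D = ρ-suc - q * r
      n²≤m : n ℕ.^ 2 ℕ.≤ suc m
      n²≤m = ℕ.+-cancelʳ-≤ (n ℕ.* 6) (n ℕ.^ 2) (suc m)
        (ℕ.≤-trans (n²+6n≤n³ 3≤n) (ℕ.≤-trans (ℕ.≤-reflexive eq) (ℕ.+-monoʳ-≤ (suc m) a≤6n)))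
      1≤ : 1ℚ ≤ ι (suc m) * (p * p)
      1≤ = subst (_≤ ι (suc m) * (p * p))
        (trans (cong (_* (p * p)) (trans (ι-* n (n ℕ.* 1)) (cong (λ j → ι n * ι j) (ℕ.*-identityʳ n))))
          (trans (regroup (ι n) p) (trans (cong₂ _*_ np≡1 np≡1) (ℚ.*-identityˡ 1ℚ))))
        (ℚ.*-monoʳ-≤-nonNeg (p * p) ⦃ ℚ.nonNegative (0≤* 0≤p 0≤p) ⦄ (ι-mono-≤ n²≤m))
        where
        open +-*-Solver
        regroup : ∀ i p → i * i * (p * p) ≡ i * p * (i * p)
        regroup = solve 2 (λ i p → i :* i :* (p :* p) := i :* p :* (i :* p)) refl
      pa≤6 : p * ι a ≤ lit 6
      pa≤6 = ℚ.≤-trans (ℚ.*-monoˡ-≤-nonNeg p ⦃ ℚ.nonNegative 0≤p ⦄ (ι-mono-≤ a≤6n))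
        (ℚ.≤-reflexive (trans (cong (p *_) (ι-* n 6)) (trans (sym (ℚ.*-assoc p (ι n) (ι 6)))
          (trans (cong (_* ι 6) (trans (ℚ.*-comm p (ι n)) np≡1)) (trans (ℚ.*-identityˡ (ι 6)) (ι≡/1 6))))))
      ∣r∣≤1 : ∣ r ∣ ≤ 1ℚ
      ∣r∣≤1 = subst (λ j → ∣ ι (j C (n ℕ.^ 2)) * τ ∣ ≤ 1ℚ) (trans (cong (_∸ a) eq) (ℕ.m+n∸n≡m (suc m) a))
        (∣∣≤-nonNeg (0≤ρ a) (ρ≤1 a))

  ρ-approx′ : ∀ a → a ℕ.≤ n ℕ.* 6 → ∣ ρ a - q ^ a ∣ ≤ ι a * (lit 6 * (p * p))
  ρ-approx′ zero    _    = ℚ.≤-reflexive (trans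
    (cong ∣_∣ (trans (cong (_- 1ℚ) (trans (ℚ.*-comm _ τ) τ≡)) (ℚ.+-inverseʳ 1ℚ)))
    (sym (trans (cong (_* (lit 6 * (p * p))) ι-0) (ℚ.*-zeroˡ (lit 6 * (p * p))))))
  ρ-approx′ (suc a) a<6n = subst₂ _≤_
    (cong ∣_∣ (identity q (ρ (suc a)) (ρ a) (q ^ a)))
    (trans (ℚ.+-comm (lit 6 * (p * p)) _)
      (trans (cong (_+ lit 6 * (p * p)) (ℚ.*-identityˡ (ι a * (lit 6 * (p * p))))) (sym (ι-suc-* a (lit 6 * (p * p))))))
    (∣∣≤-+ step (∣∣≤-* ∣q∣≤1 (ρ-approx′ a a≤6n)))
    where
    a≤6n : a ℕ.≤ n ℕ.* 6
    a≤6n = ℕ.≤-trans (ℕ.n≤1+n a) a<6n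
    a<n³ : suc a ℕ.≤ n ℕ.^ 3
    a<n³ = ℕ.≤-trans a<6n (ℕ.≤-trans (ℕ.m≤n+m (n ℕ.* 6) (n ℕ.^ 2)) (n²+6n≤n³ 3≤n))
    m : ℕ
    m = n ℕ.^ 3 ∸ suc a
    suc-m≡ : n ℕ.^ 3 ∸ a ≡ suc m
    suc-m≡ = ℕ.+-∸-assoc 1 a<n³
    step : ∣ ρ (suc a) - q * ρ a ∣ ≤ lit 6 * (p * p)
    step = subst (λ j → ∣ ρ (suc a) - q * (ι (j C (n ℕ.^ 2)) * τ) ∣ ≤ lit 6 * (p * p)) (sym suc-m≡)
      (ρ-step a m a≤6n (trans (sym (ℕ.m∸n+n≡m (ℕ.≤-trans (ℕ.n≤1+n a) a<n³))) (cong (ℕ._+ a) suc-m≡)))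
    ∣q∣≤1 : ∣ q ∣ ≤ 1ℚ
    ∣q∣≤1 = ∣∣≤-nonNeg (x≤y⇒0≤y-x p≤1) (p≤q+r⇒p-r≤q {r = p} (≤-+ʳ 1ℚ 0≤p))
    open +-*-Solver
    identity : ∀ q s r w → (s - q * r) + q * (r - w) ≡ s - q * w
    identity = solve 4 (λ q s r w → (s :- q :* r) :+ q :* (r :- w) := s :- q :* w) refl

  -- At most 6n steps with error 6p² each give 36np² = 36p.
  ρ-approx : ∀ a → a ℕ.≤ n ℕ.* 6 → ∣ ρ a - q ^ a ∣ ≤ lit 36 * p
  ρ-approx a a≤6n = ℚ.≤-trans (ρ-approx′ a a≤6n) (ℚ.≤-trans
    (ℚ.*-monoʳ-≤-nonNeg (lit 6 * (p * p)) ⦃ ℚ.nonNegative (0≤* (ℚ.nonNegative⁻¹ (lit 6)) (0≤* 0≤p 0≤p)) ⦄ (ι-mono-≤ a≤6n))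
    (ℚ.≤-reflexive (trans (cong (_* (lit 6 * (p * p))) (trans (ι-* n 6) (cong (ι n *_) (ι≡/1 6))))
      (trans (identity (ι n) p) (trans (cong (λ x → lit 36 * (x * p)) np≡1) (cong (lit 36 *_) (ℚ.*-identityˡ p)))))))
    where
    open +-*-Solver
    identity : ∀ i p → i * lit 6 * (lit 6 * (p * p)) ≡ lit 36 * (i * p * p)
    identity = solve 2 (λ i p → i :* con (lit 6) :* (con (lit 6) :* (p :* p)) := con (lit 36) :* (i :* p :* p)) refl

-- The limit

limit : ℝ
limit = (-ᵣ fromℕ 1 +ᵣ fromℕ 9 *ᵣ e ^ᵣ 2 -ᵣ fromℕ 2 *ᵣ e ^ᵣ 3) /ᵣ (fromℕ 3 *ᵣ e ^ᵣ 6)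

-- The property that determines the terms of a quotient, cleared of the reciprocal. The shift by
-- `from` is the one built into `1/ᵣ_`.
/ᵣ-*-seq : ∀ x y ⦃ pos : Positiveᵣ y ⦄ k →
  seq (x /ᵣ y) k * seq y (Positiveᵣ.from pos ℕ.+ k) ≡ seq x k * 1ℚ
/ᵣ-*-seq x y ⦃ mkPositive 0<δ N δ≤y ⦄ k = trans (ℚ.*-assoc (seq x k) (Reciprocal.s y 0<δ N δ≤y k) (seq y (N ℕ.+ k)))
  (cong (seq x k *_) (trans (ℚ.*-comm (Reciprocal.s y 0<δ N δ≤y k) (seq y (N ℕ.+ k))) (Reciprocal.xs≡1 y 0<δ N δ≤y k)))

-- The positivity proof of the denominator starts at index 0, so the k-th term of the limit has
-- `eSum k` in both numerator and denominator.
limit-*-denominator : ∀ k → let E = eSum k in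
  seq limit k * (lit 3 * (E * (E * (E * (E * (E * (E * 1ℚ)))))))
    ≡ (- 1ℚ + lit 9 * (E * (E * 1ℚ)) + - (lit 2 * (E * (E * (E * 1ℚ))))) * 1ℚ
limit-*-denominator k = /ᵣ-*-seq (-ᵣ fromℕ 1 +ᵣ fromℕ 9 *ᵣ e ^ᵣ 2 -ᵣ fromℕ 2 *ᵣ e ^ᵣ 3) (fromℕ 3 *ᵣ e ^ᵣ 6) k

-- Three times the expression of the theorem, written in z = 1/E: (-1 + 9E² - 2E³)/E⁶ = 9z⁴ - 2z³ -
-- z⁶.
g : ℚ → ℚ
g z = z * z * z * (lit 9 * z - lit 2 - z * z * z)

3*limit≡g : ∀ k z → z * eSum k ≡ 1ℚ → lit 3 * seq limit k ≡ g z
3*limit≡g k z zE≡1 = begin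
  lit 3 * L                                                   ≡⟨ trans (cong (λ c → lit 3 * L * (c * c * (c * c) * (c * c))) zE≡1) (ℚ.*-identityʳ _) ⟨
  lit 3 * L * (z * E * (z * E) * (z * E * (z * E)) * (z * E * (z * E)))
                                                              ≡⟨ identity₁ L z E ⟩
  L * (lit 3 * (E * (E * (E * (E * (E * (E * 1ℚ))))))) * (z * z * z * (z * z * z))
                                                              ≡⟨ cong (_* (z * z * z * (z * z * z))) (limit-*-denominator k) ⟩
  (- 1ℚ + lit 9 * (E * (E * 1ℚ)) + - (lit 2 * (E * (E * (E * 1ℚ))))) * 1ℚ * (z * z * z * (z * z * z))
                                                              ≡⟨ identity₂ z E ⟩
  z * z * z * (lit 9 * z * (z * E * (z * E)) - lit 2 * (z * E * (z * E) * (z * E)) - z * z * z)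
                                                              ≡⟨ cong (λ c → z * z * z * (lit 9 * z * (c * c) - lit 2 * (c * c * c) - z * z * z)) zE≡1 ⟩
  z * z * z * (lit 9 * z * 1ℚ - lit 2 - z * z * z)            ≡⟨ cong (λ x → z * z * z * (x - lit 2 - z * z * z)) (ℚ.*-identityʳ (lit 9 * z)) ⟩
  g z                                                         ∎
  where
  open ≡-Reasoning
  open +-*-Solver
  L E : ℚ
  L = seq limit k
  E = eSum k
  identity₁ : ∀ L z E → lit 3 * L * (z * E * (z * E) * (z * E * (z * E)) * (z * E * (z * E)))
                          ≡ L * (lit 3 * (E * (E * (E * (E * (E * (E * 1ℚ))))))) * (z * z * z * (z * z * z))
  identity₁ = solve 3 (λ L z E → con (lit 3) :* L :* (z :* E :* (z :* E) :* (z :* E :* (z :* E)) :* (z :* E :* (z :* E)))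
    := L :* (con (lit 3) :* (E :* (E :* (E :* (E :* (E :* (E :* con 1ℚ))))))) :* (z :* z :* z :* (z :* z :* z))) refl
  identity₂ : ∀ z E → (- 1ℚ + lit 9 * (E * (E * 1ℚ)) + - (lit 2 * (E * (E * (E * 1ℚ))))) * 1ℚ * (z * z * z * (z * z * z))
    ≡ z * z * z * (lit 9 * z * (z * E * (z * E)) - lit 2 * (z * E * (z * E) * (z * E)) - z * z * z)
  identity₂ = solve 2 (λ z E → (con (- 1ℚ) :+ con (lit 9) :* (E :* (E :* con 1ℚ)) :+ :- (con (lit 2) :* (E :* (E :* (E :* con 1ℚ))))) :* con 1ℚ :* (z :* z :* z :* (z :* z :* z))
    := z :* z :* z :* (con (lit 9) :* z :* (z :* E :* (z :* E)) :- con (lit 2) :* (z :* E :* (z :* E) :* (z :* E)) :- z :* z :* z)) refl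

-- The difference is w - z times a polynomial in w and z; 48 = 9·4 + 2·3 + 3·2 bounds that
-- polynomial term by term.
g-lipschitz : ∀ {w z d} → ∣ w ∣ ≤ 1ℚ → ∣ z ∣ ≤ 1ℚ → ∣ w - z ∣ ≤ d → ∣ g w - g z ∣ ≤ d * lit 48
g-lipschitz {w} {z} {d} w≤ z≤ wz≤ = subst (λ x → ∣ x ∣ ≤ d * lit 48) (identity w z)
  (∣∣≤-* wz≤
    (∣∣≤-- (∣∣≤-- (∣∣≤-* (∣∣≤-lit 9) (∣∣≤-+ (∣∣≤-+ (∣∣≤-+ (∣∣≤-* w² w≤) (∣∣≤-* w² z≤)) (∣∣≤-* w≤ z²)) (∣∣≤-* z² z≤)))
                  (∣∣≤-* (∣∣≤-lit 2) (∣∣≤-+ (∣∣≤-+ w² (∣∣≤-* w≤ z≤)) z²)))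
           (∣∣≤-* (∣∣≤-+ (∣∣≤-+ w² (∣∣≤-* w≤ z≤)) z²) (∣∣≤-+ (∣∣≤-* w² w≤) (∣∣≤-* z² z≤)))))
  where
  w² : ∣ w * w ∣ ≤ 1ℚ
  w² = ∣∣≤-* w≤ w≤
  z² : ∣ z * z ∣ ≤ 1ℚ
  z² = ∣∣≤-* z≤ z≤
  open +-*-Solver
  identity : ∀ w z →
    (w - z) * (lit 9 * (w * w * w + w * w * z + w * (z * z) + z * z * z) - lit 2 * (w * w + w * z + z * z)
                - (w * w + w * z + z * z) * (w * w * w + z * z * z)) ≡ g w - g z
  identity = solve 2 (λ w z →
    (w :- z) :* (con (lit 9) :* (w :* w :* w :+ w :* w :* z :+ w :* (z :* z) :+ z :* z :* z) :- con (lit 2) :* (w :* w :+ w :* z :+ z :* z)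
                  :- (w :* w :+ w :* z :+ z :* z) :* (w :* w :* w :+ z :* z :* z))
      := w :* w :* w :* (con (lit 9) :* w :- con (lit 2) :- w :* w :* w) :- z :* z :* z :* (con (lit 9) :* z :- con (lit 2) :- z :* z :* z)) refl

-- Rational sums over the board and their error bounds

ι-∑ : ∀ n (f : Fin n → ℕ) → ι (∑ℕ.sum f) ≡ ∑[ i < n ] ι (f i)
ι-∑ zero    f = ι-0
ι-∑ (suc n) f = trans (ι-+ (f zero) _) (cong (_+_ (ι (f zero))) (ι-∑ n (λ i → f (suc i))))

∑-∣-∣≤ : ∀ n {f h : Fin n → ℚ} {c} → (∀ i → ∣ f i - h i ∣ ≤ c) → ∣ ∑[ i < n ] f i - ∑[ i < n ] h i ∣ ≤ ι n * c
∑-∣-∣≤ zero    {c = c} _ = ℚ.≤-reflexive (sym (trans (cong (_* c) ι-0) (ℚ.*-zeroˡ c)))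
∑-∣-∣≤ (suc n) {f} {h} {c} f≈h = subst₂ _≤_
  (cong ∣_∣ (+-difference (f zero) (h zero) _ _))
  (trans (ℚ.+-comm c _) (sym (ι-suc-* n c)))
  (∣∣≤-+ (f≈h zero) (∑-∣-∣≤ n (λ i → f≈h (suc i))))

/≡ι*1/ : ∀ m n .⦃ _ : NonZero n ⦄ → + m / n ≡ ι m * (+ 1 / n)
/≡ι*1/ m n = begin
  + m / n                            ≡⟨ ℚ.*-identityʳ (+ m / n) ⟨
  + m / n * 1ℚ                       ≡⟨ cong (+ m / n *_) (trans (sym ι-1) (trans (sym (/-*-ι 1 n)) (ℚ.*-comm (+ 1 / n) (ι n)))) ⟩
  + m / n * (ι n * (+ 1 / n))        ≡⟨ ℚ.*-assoc (+ m / n) (ι n) (+ 1 / n) ⟨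
  + m / n * ι n * (+ 1 / n)          ≡⟨ cong (_* (+ 1 / n)) (/-*-ι m n) ⟩
  ι m * (+ 1 / n)                    ∎
  where open ≡-Reasoning

∑³ : ∀ n → (Fin n → Fin n → Fin n → ℚ) → ℚ
∑³ n f = ∑[ i < n ] ∑[ j < n ] ∑[ k < n ] f i j k

∑³-cong : ∀ n {f h : Fin n → Fin n → Fin n → ℚ} → (∀ i j k → f i j k ≡ h i j k) → ∑³ n f ≡ ∑³ n h
∑³-cong n f≡h = sum-cong-≗ {n} λ i → sum-cong-≗ {n} λ j → sum-cong-≗ {n} λ k → f≡h i j k

*-distribˡ-∑³ : ∀ n c (f : Fin n → Fin n → Fin n → ℚ) → ∑³ n (λ i j k → c * f i j k) ≡ c * ∑³ n f
*-distribˡ-∑³ n c f = trans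
  (sum-cong-≗ {n} λ i → trans
    (sum-cong-≗ {n} λ j → sym (*-distribˡ-sum {n} c (f i j)))
    (sym (*-distribˡ-sum {n} c (λ j → ∑[ k < n ] f i j k))))
  (sym (*-distribˡ-sum {n} c (λ i → ∑[ j < n ] ∑[ k < n ] f i j k)))

-- The proportion compared with the terms of the limit

module Approximation (n : ℕ) .⦃ nonZero : NonZero n ⦄ (3≤n : 3 ℕ.≤ n) where

  p q Q w : ℚ
  p = + 1 / n
  q = 1ℚ - p
  Q = q * q
  w = q ^ n

  T : ℕ
  T = length (configurations n)

  τ : ℚ
  τ = _/_ (+ 1) T ⦃ configurations-nonZero n ⦄

  0≤p : 0ℚ ≤ p
  0≤p = ℚ.nonNegative⁻¹ p ⦃ ℚ.normalize-nonNeg 1 n ⦄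

  pn≡1 : p * ι n ≡ 1ℚ
  pn≡1 = trans (/-*-ι 1 n) ι-1

  np≡1 : ι n * p ≡ 1ℚ
  np≡1 = trans (ℚ.*-comm (ι n) p) pn≡1

  p≤1 : p ≤ 1ℚ
  p≤1 = subst₂ _≤_ (ℚ.*-identityʳ p) pn≡1
    (ℚ.*-monoˡ-≤-nonNeg p ⦃ ℚ.nonNegative 0≤p ⦄ (subst (_≤ ι n) ι-1 (ι-mono-≤ (ℕ.≤-trans (s≤s z≤n) 3≤n))))

  0≤τ : 0ℚ ≤ τ
  0≤τ = ℚ.nonNegative⁻¹ τ ⦃ ℚ.normalize-nonNeg 1 T ⦃ configurations-nonZero n ⦄ ⦄

  τ≡ : τ * ι ((n ℕ.^ 3) C (n ℕ.^ 2)) ≡ 1ℚ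
  τ≡ = trans (cong (λ m → τ * ι m) (sym (length-configurations n)))
    (trans (/-*-ι 1 T ⦃ configurations-nonZero n ⦄) ι-1)

  open Avoidance 3≤n 0≤p p≤1 np≡1 0≤τ τ≡

  at : Fin n → Fin n → Fin n → Space n
  at i j k = i ∷ j ∷ k ∷ []

  1/n³≡p³ : _/_ (+ 1) (n ℕ.^ 3) ⦃ ℕ.m^n≢0 n 3 ⦄ ≡ p * p * p
  1/n³≡p³ = begin
    v                                          ≡⟨ trans (cong (λ c → v * (c * c * c)) np≡1) (ℚ.*-identityʳ v) ⟨
    v * (ι n * p * (ι n * p) * (ι n * p))      ≡⟨ regroup v (ι n) p ⟩
    v * (ι n * (ι n * ι n)) * (p * p * p)      ≡⟨ cong (λ x → v * x * (p * p * p)) n³≡ ⟨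
    v * ι (n ℕ.^ 3) * (p * p * p)              ≡⟨ cong (_* (p * p * p)) (trans (/-*-ι 1 (n ℕ.^ 3) ⦃ ℕ.m^n≢0 n 3 ⦄) ι-1) ⟩
    1ℚ * (p * p * p)                           ≡⟨ ℚ.*-identityˡ (p * p * p) ⟩
    p * p * p                                  ∎
    where
    open ≡-Reasoning
    v : ℚ
    v = _/_ (+ 1) (n ℕ.^ 3) ⦃ ℕ.m^n≢0 n 3 ⦄
    n³≡ : ι (n ℕ.^ 3) ≡ ι n * (ι n * ι n)
    n³≡ = trans (ι-* n (n ℕ.^ 2)) (cong (ι n *_) (trans (ι-* n (n ℕ.^ 1)) (cong (λ m → ι n * ι m) (ℕ.*-identityʳ n))))
    open +-*-Solver
    regroup : ∀ v i p → v * (i * p * (i * p) * (i * p)) ≡ v * (i * (i * i)) * (p * p * p)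
    regroup = solve 3 (λ v i p → v :* (i :* p :* (i :* p) :* (i :* p)) := v :* (i :* (i :* i)) :* (p :* p :* p)) refl

  unattacked : Space n → ℕ
  unattacked x = length (filter (unattacking? x) (spaces n))

  τ*unattackedCn²≡ρ : ∀ x → τ * ι (unattacked x C (n ℕ.^ 2)) ≡ ρ (attackers x)
  τ*unattackedCn²≡ρ x = trans (ℚ.*-comm τ _) (cong (λ m → ι (m C (n ℕ.^ 2)) * τ)
    (trans (sym (ℕ.m+n∸n≡m (unattacked x) (attackers x))) (cong (_∸ attackers x) (unattacking+attackers x))))

  proportion≡ : expectedSafeProportion n ≡ p * p * p * ∑³ n (λ i j k → ρ (attackers (at i j k)))
  proportion≡ = begin
    expectedSafeProportion n
      ≡⟨ cong₂ _*_ (/≡ι*1/ (ℕ.sum (map safeCount (configurations n))) T ⦃ configurations-nonZero n ⦄) 1/n³≡p³ ⟩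
    ι (ℕ.sum (map safeCount (configurations n))) * τ * (p * p * p)
      ≡⟨ trans (ℚ.*-comm _ (p * p * p)) (cong (p * p * p *_) (trans (ℚ.*-comm _ τ) (cong (τ *_) count≡))) ⟩
    p * p * p * (τ * ∑³ n (λ i j k → ι (unattacked (at i j k) C (n ℕ.^ 2))))
      ≡⟨ cong (p * p * p *_) (trans (sym (*-distribˡ-∑³ n τ _)) (∑³-cong n (λ i j k → τ*unattackedCn²≡ρ (at i j k)))) ⟩
    p * p * p * ∑³ n (λ i j k → ρ (attackers (at i j k))) ∎
    where
    open ≡-Reasoning
    count≡ : ι (ℕ.sum (map safeCount (configurations n))) ≡ ∑³ n (λ i j k → ι (unattacked (at i j k) C (n ℕ.^ 2)))
    count≡ = trans (cong ι (trans (sum-safeCount n) (sum-spaces n (λ x → unattacked x C (n ℕ.^ 2)))))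
      (trans (ι-∑ n _) (sum-cong-≗ {n} λ i → trans (ι-∑ n _) (sum-cong-≗ {n} λ j → ι-∑ n _)))

  0≤q : 0ℚ ≤ q
  0≤q = x≤y⇒0≤y-x p≤1

  q≤1 : q ≤ 1ℚ
  q≤1 = p≤q+r⇒p-r≤q {r = p} (≤-+ʳ 1ℚ 0≤p)

  ∣w∣≤1 : ∣ w ∣ ≤ 1ℚ
  ∣w∣≤1 = ∣∣≤-^ (∣∣≤-nonNeg 0≤q q≤1) n

  q^[attackers+2]≡ : ∀ i j k → q ^ attackers (at i j k) * (q * (q * 1ℚ)) ≡ w * w * w * K₃ Q (depth i) (depth j) (depth k)
  q^[attackers+2]≡ i j k = begin
    q ^ attackers (at i j k) * q ^ 2             ≡⟨ ^-homo-* q (attackers (at i j k)) 2 ⟨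
    q ^ (attackers (at i j k) ℕ.+ 2)             ≡⟨ cong (q ^_) (attackers+2≡ i j k) ⟩
    q ^ (n ℕ.* 3 ℕ.+ 2 ℕ.* exponent i j k)       ≡⟨ ^-homo-* q (n ℕ.* 3) (2 ℕ.* exponent i j k) ⟩
    q ^ (n ℕ.* 3) * q ^ (2 ℕ.* exponent i j k)   ≡⟨ cong₂ _*_ (^-assocʳ q n 3) (^-assocʳ q 2 (exponent i j k)) ⟨
    w ^ 3 * (q ^ 2) ^ exponent i j k             ≡⟨ cong₂ (λ x y → x * y ^ exponent i j k) (cube w) (cong (q *_) (ℚ.*-identityʳ q)) ⟩
    w * w * w * K₃ Q (depth i) (depth j) (depth k) ∎
    where
    open ≡-Reasoning
    open +-*-Solver
    cube : ∀ w → w * (w * (w * 1ℚ)) ≡ w * w * w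
    cube = solve 1 (λ w → w :* (w :* (w :* con 1ℚ)) := w :* w :* w) refl

  -- 36p comes from `ρ-approx`. The count is known for A + 2 rather than A, and q^A - q^(A+2) = q^A
  -- · p(1 + q) costs another 2p.
  ρ-attackers-approx : ∀ i j k →
    ∣ ρ (attackers (at i j k)) - w * w * w * K₃ Q (depth i) (depth j) (depth k) ∣ ≤ lit 38 * p
  ρ-attackers-approx i j k = subst₂ (λ x y → ∣ ρ a - x ∣ ≤ y) (q^[attackers+2]≡ i j k) (bound p)
    (∣-∣≤-trans {x = ρ a} (q ^ a) (ρ-approx a (attackers≤ i j k))
      (subst (λ x → ∣ x ∣ ≤ 1ℚ * (p * (1ℚ + 1ℚ))) (identity p (q ^ a))
        (∣∣≤-* (∣∣≤-^ ∣q∣≤1 a) (∣∣≤-* (∣∣≤-self 0≤p) (∣∣≤-+ (ℚ.≤-refl {∣ 1ℚ ∣}) ∣q∣≤1)))))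
    where
    a : ℕ
    a = attackers (at i j k)
    ∣q∣≤1 : ∣ q ∣ ≤ 1ℚ
    ∣q∣≤1 = ∣∣≤-nonNeg 0≤q q≤1
    open +-*-Solver
    identity : ∀ p x → x * (p * (1ℚ + (1ℚ - p))) ≡ x - x * ((1ℚ - p) * ((1ℚ - p) * 1ℚ))
    identity = solve 2 (λ p x → x :* (p :* (con 1ℚ :+ (con 1ℚ :- p))) := x :- x :* ((con 1ℚ :- p) :* ((con 1ℚ :- p) :* con 1ℚ))) refl
    bound : ∀ p → lit 36 * p + 1ℚ * (p * (1ℚ + 1ℚ)) ≡ lit 38 * p
    bound = solve 1 (λ p → con (lit 36) :* p :+ con 1ℚ :* (p :* (con 1ℚ :+ con 1ℚ)) := con (lit 38) :* p) refl

  -- Averaging over the n³ spaces preserves the error 38p, and 114 = 3·38.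
  proportion-approx-S₃ :
    ∣ lit 3 * expectedSafeProportion n - w * w * w * (lit 3 * (p * p * p) * S₃ Q n) ∣ ≤ lit 114 * p
  proportion-approx-S₃ = subst₂ _≤_
    (cong ∣_∣ (trans (identity (p * p * p) Σρ (w * w * w) (S₃ Q n))
      (cong (λ x → lit 3 * x - w * w * w * (lit 3 * (p * p * p) * S₃ Q n)) (sym proportion≡))))
    (trans (bound p (ι n)) (trans (cong (λ c → lit 114 * p * (c * c * c)) np≡1) (ℚ.*-identityʳ (lit 114 * p))))
    (∣∣≤-* (∣∣≤-* (∣∣≤-lit 3) (∣∣≤-self (0≤* (0≤* 0≤p 0≤p) 0≤p)))
      (subst (λ x → ∣ Σρ - x ∣ ≤ ι n * (ι n * (ι n * (lit 38 * p)))) (*-distribˡ-∑³ n (w * w * w) (λ i j k → K₃ Q (depth i) (depth j) (depth k)))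
        (∑-∣-∣≤ n λ i → ∑-∣-∣≤ n λ j → ∑-∣-∣≤ n λ k → ρ-attackers-approx i j k)))
    where
    Σρ : ℚ
    Σρ = ∑³ n (λ i j k → ρ (attackers (at i j k)))
    open +-*-Solver
    identity : ∀ p³ r w³ s → lit 3 * p³ * (r - w³ * s) ≡ lit 3 * (p³ * r) - w³ * (lit 3 * p³ * s)
    identity = solve 4 (λ p³ r w³ s → con (lit 3) :* p³ :* (r :- w³ :* s) := con (lit 3) :* (p³ :* r) :- w³ :* (con (lit 3) :* p³ :* s)) refl
    bound : ∀ p i → lit 3 * (p * p * p) * (i * (i * (i * (lit 38 * p)))) ≡ lit 114 * p * (i * p * (i * p) * (i * p))
    bound = solve 2 (λ p i → con (lit 3) :* (p :* p :* p) :* (i :* (i :* (i :* (con (lit 38) :* p))))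
                               := con (lit 114) :* p :* (i :* p :* (i :* p) :* (i :* p))) refl

  -- At m = n the variable t equals 1, where f₃ is 9w - 2 - w³, and w³ times this is g w.
  S₃-approx-g : ∣ w * w * w * (lit 3 * (p * p * p) * S₃ Q n) - g w ∣ ≤ lit 400 * p
  S₃-approx-g = subst₂ _≤_
    (cong ∣_∣ (trans (identity (w * w * w) (lit 3 * (p * p * p) * S₃ Q n) (f₃ 0≤p p≤1 n))
      (cong (λ x → w * w * w * (lit 3 * (p * p * p) * S₃ Q n) - x)
        (trans (cong (λ t → w * w * w * (lit 6 * t - lit 8 + lit 9 * w - w * w * w)) np≡1) (w³f₃≡g w)))))
    (trans (ℚ.*-identityˡ _) (cong (lit 400 *_) (trans (cong (p *_) np≡1) (ℚ.*-identityʳ p))))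
    (∣∣≤-* (∣∣≤-* (∣∣≤-* ∣w∣≤1 ∣w∣≤1) ∣w∣≤1) (S₃-approx 0≤p p≤1 n (ℚ.≤-reflexive np≡1)))
    where
    open +-*-Solver
    identity : ∀ a b c → a * (b - c) ≡ a * b - a * c
    identity = solve 3 (λ a b c → a :* (b :- c) := a :* b :- a :* c) refl
    w³f₃≡g : ∀ w → w * w * w * (lit 6 * 1ℚ - lit 8 + lit 9 * w - w * w * w) ≡ g w
    w³f₃≡g = solve 1 (λ w → w :* w :* w :* (con (lit 6) :* con 1ℚ :- con (lit 8) :+ con (lit 9) :* w :- w :* w :* w)
                              := w :* w :* w :* (con (lit 9) :* w :- con (lit 2) :- w :* w :* w)) refl

  module _ {k : ℕ} (n≤k : n ℕ.≤ k) where

    private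
      E : ℚ
      E = eSum k

      1≤E : 1ℚ ≤ E
      1≤E = subst (λ j → eSum 0 ≤ eSum j) (ℕ.+-identityʳ k) (eSum-lower 0 k)

      0<E : 0ℚ < E
      0<E = ℚ.<-≤-trans (ℚ.positive⁻¹ 1ℚ) 1≤E

      z : ℚ
      z = (1/ E) ⦃ ℚ.>-nonZero 0<E ⦄

      zE≡1 : z * E ≡ 1ℚ
      zE≡1 = ℚ.*-inverseˡ E ⦃ ℚ.>-nonZero 0<E ⦄

      0≤z : 0ℚ ≤ z
      0≤z = ℚ.<⇒≤ (ℚ.positive⁻¹ z ⦃ ℚ.1/pos⇒pos E ⦃ ℚ.positive 0<E ⦄ ⦄)

      z≤1 : z ≤ 1ℚ
      z≤1 = subst₂ _≤_ (ℚ.*-identityʳ z) zE≡1 (ℚ.*-monoˡ-≤-nonNeg z ⦃ ℚ.nonNegative 0≤z ⦄ 1≤E)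

      ∣z∣≤1 : ∣ z ∣ ≤ 1ℚ
      ∣z∣≤1 = ∣∣≤-nonNeg 0≤z z≤1

    -- z - w = z(1 - wE), where 0 ≤ z ≤ 1 and 1 - wE lies between 0 and p.
    ∣w-z∣≤p : ∣ w - z ∣ ≤ p
    ∣w-z∣≤p = subst₂ _≤_
      (trans (cong ∣_∣ (trans (identity w z E) (trans (cong (λ c → z - w * c) zE≡1) (cong (_-_ z) (ℚ.*-identityʳ w))))) (∣-∣-sym z w))
      (ℚ.*-identityˡ p)
      (∣∣≤-* ∣z∣≤1 (∣∣≤-nonNeg (x≤y⇒0≤y-x ([1-h]^n*eSum≤1 0≤p p≤1 np≡1 k)) 1-wE≤p))
      where
      open +-*-Solver
      identity : ∀ w z E → z * (1ℚ - w * E) ≡ z - w * (z * E)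
      identity = solve 3 (λ w z E → z :* (con 1ℚ :- w :* E) := z :- w :* (z :* E)) refl
      rearrange : ∀ p x → 1ℚ - x + (x - (1ℚ - p)) ≡ p
      rearrange = solve 2 (λ p x → con 1ℚ :- x :+ (x :- (con 1ℚ :- p)) := p) refl
      1-wE≤p : 1ℚ - w * E ≤ p
      1-wE≤p = ≤-by (x≤y⇒0≤y-x (1-h≤[1-h]^n*eSum 0≤p p≤1 np≡1 n≤k)) (rearrange p (w * E))

    -- 562 = 114 + 400 + 48: the passage to S₃, its approximation by g w, and the replacement of w
    -- by z in g.
    3*proportion-approx : ∣ lit 3 * (expectedSafeProportion n - seq limit k) ∣ ≤ lit 562 * p
    3*proportion-approx = subst₂ _≤_
      (cong ∣_∣ (trans (cong (λ x → lit 3 * expectedSafeProportion n - x) (sym (3*limit≡g k z zE≡1)))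
        (identity (expectedSafeProportion n) (seq limit k))))
      (bound p)
      (∣-∣≤-trans {x = lit 3 * expectedSafeProportion n} (g w) (∣-∣≤-trans {x = lit 3 * expectedSafeProportion n} (w * w * w * (lit 3 * (p * p * p) * S₃ Q n)) proportion-approx-S₃ S₃-approx-g)
        (g-lipschitz ∣w∣≤1 ∣z∣≤1 ∣w-z∣≤p))
      where
      open +-*-Solver
      identity : ∀ x y → lit 3 * x - lit 3 * y ≡ lit 3 * (x - y)
      identity = solve 2 (λ x y → con (lit 3) :* x :- con (lit 3) :* y := con (lit 3) :* (x :- y)) refl
      bound : ∀ p → lit 114 * p + lit 400 * p + p * lit 48 ≡ lit 562 * p
      bound = solve 1 (λ p → con (lit 114) :* p :+ con (lit 400) :* p :+ p :* con (lit 48) := con (lit 562) :* p) refl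

    proportion-approx : ∣ expectedSafeProportion n - seq limit k ∣ ≤ lit 562 * p
    proportion-approx = ℚ.≤-trans
      (≤-by (0≤* (ℚ.nonNegative⁻¹ (lit 2)) (ℚ.0≤∣p∣ d)) (trans (identity ∣ d ∣) (sym (ℚ.∣p*q∣≡∣p∣*∣q∣ (lit 3) d))))
      3*proportion-approx
      where
      d : ℚ
      d = expectedSafeProportion n - seq limit k
      open +-*-Solver
      identity : ∀ x → x + lit 2 * x ≡ lit 3 * x
      identity = solve 1 (λ x → x :+ con (lit 2) :* x := con (lit 3) :* x) refl

mainTheorem6 : Converges (λ n → fromℚ (expectedSafeProportion n))
    ((-ᵣ fromℕ 1 +ᵣ fromℕ 9 *ᵣ e ^ᵣ 2 -ᵣ fromℕ 2 *ᵣ e ^ᵣ 3) /ᵣ (fromℕ 3 *ᵣ e ^ᵣ 6))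
mainTheorem6 ε (mkPositive {δ} 0<δ M δ≤ε) = N , λ n N≤n → mkPositive (0<½* 0<δ) (M ℕ.⊔ n) λ k M⊔n≤k →
  subst (_≤ seq ε k - ∣ expectedSafeProportion n - seq limit k ∣) (half δ)
    (ℚ.+-mono-≤ (δ≤ε k (ℕ.m⊔n≤o⇒m≤o M n M⊔n≤k))
      (ℚ.neg-antimono-≤ (ℚ.≤-trans
        (Approximation.proportion-approx n (ℕ.m⊔n≤o⇒m≤o 3 (suc (ℚ.↧ₙ ε′)) N≤n) (ℕ.m⊔n≤o⇒n≤o M n M⊔n≤k))
        (small n N≤n))))
  where
  -- ε is eventually at least δ, and half of δ is left for the error 562/n. The index n must exceed
  -- the denominator of ε′ so that 1/n < ε′, and be at least 3 for `Approximation`.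
  ε′ : ℚ
  ε′ = ½ * δ * (+ 1 / 562)
  N : ℕ
  N = 3 ℕ.⊔ suc (ℚ.↧ₙ ε′)
  open +-*-Solver
  half : ∀ δ → δ - ½ * δ ≡ ½ * δ
  half = solve 1 (λ δ → δ :- con ½ :* δ := con ½ :* δ) refl
  scale : ∀ δ → lit 562 * (½ * δ * (+ 1 / 562)) ≡ ½ * δ
  scale = solve 1 (λ δ → con (lit 562) :* (con ½ :* δ :* con (+ 1 / 562)) := con ½ :* δ) refl
  small : ∀ n .⦃ _ : NonZero n ⦄ → N ℕ.≤ n → lit 562 * (+ 1 / n) ≤ ½ * δ
  small n N≤n = subst (lit 562 * (+ 1 / n) ≤_) (scale δ)
    (ℚ.*-monoˡ-≤-nonNeg (lit 562) (ℚ.<⇒≤ (1/-small n ε′ (0<* (0<½* 0<δ) (ℚ.positive⁻¹ (+ 1 / 562))) (ℕ.m⊔n≤o⇒n≤o 3 (suc (ℚ.↧ₙ ε′)) N≤n))))
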